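{- For every fixed integer $r\ge 9$ and every real number $M>0$, there exist a finite abelian group $G$ of rank $r$ and a zero-sum-free sequence $S$ over $G$ such that $|S|=\mathsf d^*(G)$ and $\mathsf k(S)>M$. In particular, the following assertion is false: for every finite abelian group $G= C_{n_1}\oplus\cdots\oplus C_{n_r}$ with $1<n_1\mid\cdots\mid n_r$, every zero-sum-free sequence $S$ over $G$ with $|S|\ge\mathsf d^*(G)$ satisfies $\mathsf k(S)\le\sum_{i=1}^r\frac{n_i-1}{n_i}$.
   Context: All groups are finite, abelian and written additively; $C_n$ denotes the cyclic group of order $n$. The rank of a group is its minimum number of generators. A sequence $S=g_1\cdots g_\ell$ over $G$ is a finite unordered multiset of elements of $G$ of length $|S|=\ell$ (counted with multiplicity). It is zero-sum free if no nonempty subsequence (sub-multiset) has sum $0$; in particular its terms are nonzero. The cross number of a sequence $S=g_1\cdots g_\ell$ of nonzero elements is $\mathsf k(S)=\sum_{i=1}^\ell \frac{1}{\operatorname{ord}(g_i)}$. If $G\cong C_{n_1}\oplus\cdots\oplus C_{n_s}$ with $1<n_1\mid\cdots\mid n_s$, then $\mathsf d^*(G)=\sum_{i=1}^s(n_i-1)$. -}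

module Defs where

open import Algebra.Bundles using (AbelianGroup)
import Algebra.Construct.DirectProduct as DirectProduct
import Algebra.Construct.Terminal as Terminal
import Algebra.Definitions.RawMonoid as RawMonoidDefs
open import Algebra.Morphism.Structures using (module GroupMorphisms)
open import Data.Fin.Base using (Fin)
open import Data.Integer.Base as ℤ using (ℤ; +_)
import Data.Integer.Divisibility.Signed as ℤ
import Data.Integer.Properties as ℤ
open import Data.Integer.Tactic.RingSolver using (solve-∀)
open import Data.List.Base using (List; []; _∷_; foldr; length)
open import Data.List.Membership.Propositional using (_∈_)
open import Data.List.Relation.Binary.Sublist.Propositional using (_⊆_)
open import Data.List.Relation.Unary.All using (All; []; _∷_)
open import Data.Nat.Base as ℕ using (ℕ; NonZero)
import Data.Nat.Divisibility as ℕ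
import Data.Nat.Properties as ℕ
open import Data.Product.Base using (Σ-syntax; ∃-syntax; _×_; _,_)
open import Data.Rational.Base as ℚ using (ℚ; 0ℚ)
open import Data.Sum.Base using (_⊎_)
open import Data.Vec.Base as Vec using (Vec; []; _∷_)
import Data.Vec.Relation.Unary.All as VecAll
import Data.Vec.Relation.Unary.Linked as VecLinked
open import Function.Bundles using (Inverse; _⇔_)
open import Level using (0ℓ)
open import Relation.Binary.PropositionalEquality
  using (_≡_; _≢_; refl; subst; setoid)
open import Relation.Nullary.Negation using (¬_)

-- Dedekind cuts: L q and U q mean q < x and x < q respectively.
record ℝ : Set₁ where
  field
    L U         : ℚ → Set
    L-inhabited : ∃[ q ] L q
    U-inhabited : ∃[ q ] U q
    L-rounded   : ∀ q → L q ⇔ (∃[ p ] q ℚ.< p × L p)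
    U-rounded   : ∀ q → U q ⇔ (∃[ p ] p ℚ.< q × U p)
    disjoint    : ∀ q → ¬ (L q × U q)
    located     : ∀ p q → p ℚ.< q → L p ⊎ U q

Positive : ℝ → Set
Positive x = ℝ.L x 0ℚ

infix 4 _<ʳ_

_<ʳ_ : ℝ → ℚ → Set
x <ʳ q = ℝ.U x q

-- The cyclic group of order n (for n ≥ 1), as ℤ with equality the
-- congruence modulo n.
C : ℕ → AbelianGroup 0ℓ 0ℓ
C n = record
  { Carrier = ℤ
  ; _≈_     = _≈_
  ; _∙_     = ℤ._+_
  ; ε       = ℤ.0ℤ
  ; _⁻¹     = ℤ.-_
  ; isAbelianGroup = record
    { isGroup = record
      { isMonoid = record
        { isSemigroup = record
          { isMagma = record
            { isEquivalence = record
              { refl  = λ {x} → ≡⇒≈ {x} refl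
              ; sym   = λ {x} {y} p →
                  subst (+ n ℤ.∣_) (swap x y) (ℤ.∣m⇒∣-m p)
              ; trans = λ {x} {y} {z} p q →
                  subst (+ n ℤ.∣_) (telescope x y z) (ℤ.∣m∣n⇒∣m+n p q)
              }
            ; ∙-cong = λ {x} {y} {u} {v} p q →
                subst (+ n ℤ.∣_) (regroup x y u v) (ℤ.∣m∣n⇒∣m+n p q)
            }
          ; assoc = λ x y z → ≡⇒≈ (ℤ.+-assoc x y z)
          }
        ; identity = (λ x → ≡⇒≈ (ℤ.+-identityˡ x)) , (λ x → ≡⇒≈ (ℤ.+-identityʳ x))
        }
      ; inverse = (λ x → ≡⇒≈ (ℤ.+-inverseˡ x)) , (λ x → ≡⇒≈ (ℤ.+-inverseʳ x))
      ; ⁻¹-cong = λ {x} {y} p →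
          subst (+ n ℤ.∣_) (negate x y) (ℤ.∣m⇒∣-m p)
      }
    ; comm = λ x y → ≡⇒≈ (ℤ.+-comm x y)
    }
  }
  where
  _≈_ : ℤ → ℤ → Set
  x ≈ y = + n ℤ.∣ x ℤ.- y

  ≡⇒≈ : ∀ {x y} → x ≡ y → x ≈ y
  ≡⇒≈ {x} refl = ℤ.divides ℤ.0ℤ (ℤ.+-inverseʳ x)

  swap : ∀ x y → ℤ.- (x ℤ.- y) ≡ y ℤ.- x
  swap = solve-∀

  telescope : ∀ x y z → (x ℤ.- y) ℤ.+ (y ℤ.- z) ≡ x ℤ.- z
  telescope = solve-∀

  regroup : ∀ x y u v →
            (x ℤ.- y) ℤ.+ (u ℤ.- v) ≡ (x ℤ.+ u) ℤ.- (y ℤ.+ v)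
  regroup = solve-∀

  negate : ∀ x y → ℤ.- (x ℤ.- y) ≡ (ℤ.- x) ℤ.- (ℤ.- y)
  negate = solve-∀

⨁C : ∀ {s} → Vec ℕ s → AbelianGroup 0ℓ 0ℓ
⨁C []       = Terminal.abelianGroup
⨁C (n ∷ ns) = DirectProduct.abelianGroup (C n) (⨁C ns)

infix 4 _≅_

_≅_ : AbelianGroup 0ℓ 0ℓ → AbelianGroup 0ℓ 0ℓ → Set
G ≅ H = Σ[ f ∈ (G.Carrier → H.Carrier) ] IsGroupIsomorphism f
  where
  module G = AbelianGroup G
  module H = AbelianGroup H
  open GroupMorphisms G.rawGroup H.rawGroup using (IsGroupIsomorphism)

module _ (G : AbelianGroup 0ℓ 0ℓ) where
  open AbelianGroup G using (Carrier; _≈_; _∙_; ε; _⁻¹; rawMonoid)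
    renaming (setoid to G-setoid)
  open RawMonoidDefs rawMonoid using () renaming (_×_ to _·_)

  Finite : Set
  Finite = ∃[ n ] Inverse G-setoid (setoid (Fin n))

  data Span (gs : List Carrier) : Carrier → Set where
    gen  : ∀ {x}   → x ∈ gs → Span gs x
    unit : Span gs ε
    add  : ∀ {x y} → Span gs x → Span gs y → Span gs (x ∙ y)
    neg  : ∀ {x}   → Span gs x → Span gs (x ⁻¹)
    resp : ∀ {x y} → x ≈ y → Span gs x → Span gs y

  Generates : List Carrier → Set
  Generates gs = ∀ x → Span gs x

  HasRank : ℕ → Set
  HasRank r = (∃[ gs ] length gs ≡ r × Generates gs)
            × (∀ gs → Generates gs → r ℕ.≤ length gs)

  record Order (g : Carrier) : Set where
    field
      ord         : ℕ
      .{{nonZero}} : NonZero ord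
      annihilates : ord · g ≈ ε
      minimal     : ∀ m → .{{NonZero m}} → m · g ≈ ε → ord ℕ.≤ m

  -- Finite sequences over G are lists.  Every notion below is invariant under
  -- permutation, and sub-multisets are sublists up to permutation.
  Seq : Set
  Seq = List Carrier

  ZeroSumFree : Seq → Set
  ZeroSumFree S = ∀ T → T ⊆ S → T ≢ [] → ¬ (foldr _∙_ ε T ≈ ε)

  -- The cross number, computed from the (unique) orders of the terms.
  k : ∀ {S : Seq} → All Order S → ℚ
  k []       = 0ℚ
  k (o ∷ os) = (+ 1 ℚ./ Order.ord o) ℚ.+ k os

  record InvariantFactors (s : ℕ) : Set where
    field
      factors : Vec ℕ s
      1<      : VecAll.All (1 ℕ.<_) factors
      chain   : VecLinked.Linked ℕ._∣_ factors
      iso     : G ≅ ⨁C factors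

d* : ∀ {G s} → InvariantFactors G s → ℕ
d* D = Vec.sum (Vec.map (ℕ._∸ 1) (InvariantFactors.factors D))

-- Σ (nᵢ - 1) / nᵢ; the hypothesis is only used to know that nᵢ is nonzero.
Σ[n-1]/n : ∀ {s} {ns : Vec ℕ s} → VecAll.All (1 ℕ.<_) ns → ℚ
Σ[n-1]/n VecAll.[] = 0ℚ
Σ[n-1]/n (VecAll._∷_ {x = n} 1<n 1<ns) =
  (+ (n ℕ.∸ 1) ℚ./ n) {{ℕ.>-nonZero (ℕ.<-trans ℕ.z<s 1<n)}} ℚ.+ Σ[n-1]/n 1<ns

CrossNumberBound : ℕ → Set₁
CrossNumberBound r =
  ∀ (G : AbelianGroup 0ℓ 0ℓ) → Finite G →
  ∀ (D : InvariantFactors G r) (S : Seq G) →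
  ZeroSumFree G S → d* D ℕ.≤ length S →
  ∀ (o : All (Order G) S) → k G o ℚ.≤ Σ[n-1]/n (InvariantFactors.1< D)

{-# OPTIONS --safe #-}
-- If h₁^m₁ ⋯ h_t^m_t is zero-sum free over K and Λ is the kernel of ℤᵗ → K, eᵢ ↦ hᵢ,
-- then the product of the eᵢ^(n (mᵢ + 1) - 1) is zero-sum free over ℤᵗ / nΛ, and its
-- length exceeds d* by n times the excess of the original sequence.
-- Over K = C₂⁴ ⊕ C₆, the seven elements (v, 0, 1) with 0 ≠ v ∈ C₂³, taken once, together
-- with (0, 1, 2), taken three times, form a zero-sum free sequence of length
-- 10 = d*(K) + 1 with only t = 8 distinct terms.  It yields a zero-sum free sequence of
-- length d* + n over C_n³ ⊕ C_{2n}⁴ ⊕ C_{6n}.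
-- In a further summand C_n the n - 1 copies of a generator can therefore be replaced by
-- a shorter sequence T with large cross number.  Such T exist for n in the recursion
-- N ↦ N (N + 1): passing from T to (N + 1) T ⋅ N^N adds N / (N + 1) ≥ 1/2 to the
-- cross number.  Ranks above 9 are reached with summands C_{6n}.

module Submission where

open import Defs
open import Algebra.Bundles using (AbelianGroup)
import Algebra.Definitions.RawMonoid as RawMonoidDefs
import Algebra.Morphism.Construct.Identity as Identity
open import Algebra.Morphism.Structures using (module MonoidMorphisms)
open import Data.Fin.Base as Fin using (Fin; zero; suc; toℕ; fromℕ<; finToFun; funToFin; combine)
open import Data.Fin.Patterns
import Data.Fin.Properties as Fin
open import Data.Integer.Base as ℤ using (ℤ; +_; -[1+_]; 0ℤ; 1ℤ; ∣_∣)
import Data.Integer.DivMod as ℤ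
open import Data.Integer.Divisibility.Signed using (_∣_; divides)
import Data.Integer.Divisibility.Signed as ℤ
import Data.Integer.Properties as ℤ
open import Data.Integer.Tactic.RingSolver using (solve-∀)
open import Data.List.Base using (List; []; _∷_; _++_; foldr; length; map; replicate)
open import Data.List.Membership.Propositional using (_∈_)
open import Data.List.Membership.Propositional.Properties using (∈-map⁺)
open import Data.List.Properties
  using (length-map; length-++; length-replicate; map-replicate; map-∘; map-id; map-cong)
open import Data.List.Relation.Binary.Sublist.Propositional using (_⊆_; []; _∷_; _∷ʳ_)
import Data.List.Relation.Binary.Sublist.Propositional.Properties as Sublist
open import Data.List.Relation.Unary.All using (All; []; _∷_)
import Data.List.Relation.Unary.All as All
import Data.List.Relation.Unary.All.Properties as AllP
open import Data.List.Relation.Unary.Any using (here; there)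
open import Data.Nat.Base as ℕ using (ℕ; zero; suc; _≤_; _<_; z≤n; s≤s; NonZero)
import Data.Nat.Divisibility as ℕ
import Data.Nat.Properties as ℕ
import Data.Nat.Tactic.RingSolver as ℕ
open import Data.Product.Base using (Σ-syntax; ∃-syntax; _×_; _,_; proj₁; proj₂)
open import Data.Product.Function.NonDependent.Setoid using (_×-inverse_)
open import Data.Product.Relation.Binary.Pointwise.NonDependent using (Pointwise-≡↔≡)
open import Data.Rational.Base as ℚ using (ℚ; 0ℚ; mkℚ)
import Data.Rational.Properties as ℚ
import Data.Rational.Unnormalised.Base as ℚᵘ
import Data.Rational.Unnormalised.Properties as ℚᵘ
open import Data.Unit.Polymorphic.Base using (tt)
open import Data.Vec.Base as Vec using (Vec; []; _∷_; lookup)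
import Data.Vec.Properties as Vec
open import Data.Vec.Relation.Binary.Pointwise.Inductive using (Pointwise; []; _∷_)
import Data.Vec.Relation.Unary.All as VecAll
import Data.Vec.Relation.Unary.All.Properties as VecAllP
import Data.Vec.Relation.Unary.Linked as VecLinked
open import Function.Base using (_∘_; id)
open import Function.Bundles using (Equivalence)
import Function.Construct.Composition as Compose
import Function.Construct.Symmetry as Symmetry
open import Level using (0ℓ)
open import Relation.Binary.Definitions using (Decidable)
open import Relation.Binary.PropositionalEquality hiding (resp)
open import Relation.Nullary using (Dec; yes; no; contradiction)
open import Relation.Nullary.Decidable using (from-yes; _×-dec_; _→-dec_)
open import Relation.Nullary.Negation using (¬_)

-- Zero-sum free sequences and homomorphisms

Ab : Set₁
Ab = AbelianGroup 0ℓ 0ℓ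

module _ (G H : Ab) where
  private
    module G = AbelianGroup G
    module H = AbelianGroup H
  open MonoidMorphisms G.rawMonoid H.rawMonoid public
    using (IsMonoidHomomorphism; IsMonoidMonomorphism)

  monoidHom : (f : G.Carrier → H.Carrier) →
              (∀ {x y} → x G.≈ y → f x H.≈ f y) →
              (∀ x y → f (x G.∙ y) H.≈ f x H.∙ f y) →
              f G.ε H.≈ H.ε → IsMonoidHomomorphism f
  monoidHom f f-cong f-∙ f-ε = record
    { isMagmaHomomorphism = record
      { isRelHomomorphism = record { cong = f-cong }
      ; homo = f-∙
      }
    ; ε-homo = f-ε
    }

sum : (G : Ab) → Seq G → AbelianGroup.Carrier G
sum G = foldr (AbelianGroup._∙_ G) (AbelianGroup.ε G)

module _ {A : Set} where
  ⊆-++-split : ∀ (xs : List A) {ys zs} → zs ⊆ xs ++ ys →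
               Σ[ us ∈ List A ] Σ[ vs ∈ List A ] us ⊆ xs × vs ⊆ ys × zs ≡ us ++ vs
  ⊆-++-split []       p = [] , _ , [] , p , refl
  ⊆-++-split (x ∷ xs) (.x ∷ʳ p) with us , vs , q , r , eq ← ⊆-++-split xs p =
    us , vs , x ∷ʳ q , r , eq
  ⊆-++-split (x ∷ xs) (refl ∷ p) with us , vs , q , r , eq ← ⊆-++-split xs p =
    x ∷ us , vs , refl ∷ q , r , cong (x ∷_) eq

  ⊆-replicate : ∀ m {x : A} {zs} → zs ⊆ replicate m x →
                ∃[ c ] c ≤ m × zs ≡ replicate c x
  ⊆-replicate zero    []         = 0 , z≤n , refl
  ⊆-replicate (suc m) (_ ∷ʳ p)   with c , c≤m , eq ← ⊆-replicate m p =
    c , ℕ.m≤n⇒m≤1+n c≤m , eq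
  ⊆-replicate (suc m) (refl ∷ p) with c , c≤m , eq ← ⊆-replicate m p =
    suc c , s≤s c≤m , cong (_ ∷_) eq

  ⊆-map : ∀ {B : Set} (f : A → B) (xs : List A) {zs} → zs ⊆ map f xs →
          Σ[ us ∈ List A ] us ⊆ xs × zs ≡ map f us
  ⊆-map f []       []         = [] , [] , refl
  ⊆-map f (x ∷ xs) (_ ∷ʳ p)   with us , q , eq ← ⊆-map f xs p = us , x ∷ʳ q , eq
  ⊆-map f (x ∷ xs) (refl ∷ p) with us , q , eq ← ⊆-map f xs p =
    x ∷ us , refl ∷ q , cong (f x ∷_) eq

module _ (G : Ab) where
  open AbelianGroup G renaming (refl to ≈-refl; sym to ≈-sym; trans to ≈-trans)

  sum-++ : ∀ xs ys → sum G (xs ++ ys) ≈ sum G xs ∙ sum G ys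
  sum-++ []       ys = ≈-sym (identityˡ _)
  sum-++ (x ∷ xs) ys = ≈-trans (∙-congˡ (sum-++ xs ys)) (≈-sym (assoc x _ _))

module Hom (G H : Ab) {f : AbelianGroup.Carrier G → AbelianGroup.Carrier H}
           (hom : IsMonoidHomomorphism G H f) where
  private
    module G = AbelianGroup G
    module H = AbelianGroup H
  open IsMonoidHomomorphism G H hom
  open RawMonoidDefs G.rawMonoid using () renaming (_×_ to _·ᴳ_)
  open RawMonoidDefs H.rawMonoid using () renaming (_×_ to _·ᴴ_)

  sum-homo : ∀ xs → f (sum G xs) H.≈ sum H (map f xs)
  sum-homo []       = ε-homo
  sum-homo (x ∷ xs) = H.trans (homo x _) (H.∙-congˡ (sum-homo xs))

  ·-homo : ∀ m x → f (m ·ᴳ x) H.≈ m ·ᴴ f x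
  ·-homo zero    x = ε-homo
  ·-homo (suc m) x = H.trans (homo x _) (H.∙-congˡ (·-homo m x))

  kills-sum : ∀ {xs} → All (λ x → f x H.≈ H.ε) xs → f (sum G xs) H.≈ H.ε
  kills-sum []       = ε-homo
  kills-sum (p ∷ ps) =
    H.trans (homo _ _) (H.trans (H.∙-cong p (kills-sum ps)) (H.identityˡ _))

  -- A zero-sum subsequence that contains a term of `ys` is mapped by `f` to a nonempty zero-sum
  -- subsequence of `map f ys`, since its terms from `xs` vanish there; one without such terms lies
  -- in `xs`. Both the recursion for large cross numbers and the direct sums rest on this.
  zeroSumFree-extension : ∀ {xs ys} → ZeroSumFree G xs → ZeroSumFree H (map f ys) →
    All (λ x → f x H.≈ H.ε) xs → ZeroSumFree G (xs ++ ys)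
  zeroSumFree-extension {xs} {ys} zsf-xs zsf-ys kills zs zs⊆ zs≢[] sum≈ε
    with ⊆-++-split xs zs⊆
  ... | us , [] , us⊆ , _ , refl =
    zsf-xs us us⊆ (λ { refl → zs≢[] refl })
      (G.trans (G.sym (G.identityʳ _)) (G.trans (G.sym (sum-++ G us [])) sum≈ε))
  ... | us , v ∷ vs , us⊆ , vs⊆ , refl =
    zsf-ys _ (Sublist.map⁺ f vs⊆) (λ ()) (begin
      sum H (map f (v ∷ vs))                ≈⟨ sum-homo (v ∷ vs) ⟨
      f (sum G (v ∷ vs))                    ≈⟨ H.identityˡ _ ⟨
      H.ε H.∙ f (sum G (v ∷ vs))            ≈⟨ H.∙-congʳ (kills-sum (us-kills us⊆)) ⟨
      f (sum G us) H.∙ f (sum G (v ∷ vs))   ≈⟨ homo _ _ ⟨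
      f (sum G us G.∙ sum G (v ∷ vs))       ≈⟨ ⟦⟧-cong (sum-++ G us (v ∷ vs)) ⟨
      f (sum G (us ++ v ∷ vs))              ≈⟨ ⟦⟧-cong sum≈ε ⟩
      f G.ε                                 ≈⟨ ε-homo ⟩
      H.ε                                   ∎)
    where
    open import Relation.Binary.Reasoning.Setoid H.setoid
    us-kills : ∀ {us} → us ⊆ xs → All (λ x → f x H.≈ H.ε) us
    us-kills p = Sublist.All-resp-⊆ p kills

module Mono (G H : Ab) {f : AbelianGroup.Carrier G → AbelianGroup.Carrier H}
            (mono : IsMonoidMonomorphism G H f) where
  private
    module G = AbelianGroup G
    module H = AbelianGroup H
  open IsMonoidMonomorphism G H mono
  open Hom G H isMonoidHomomorphism

  zeroSumFree-map : ∀ {xs} → ZeroSumFree G xs → ZeroSumFree H (map f xs)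
  zeroSumFree-map {xs} zsf zs zs⊆ zs≢[] sum≈ε
    with us , us⊆ , refl ← ⊆-map f xs zs⊆ =
    zsf us us⊆ (λ { refl → zs≢[] refl })
      (injective (H.trans (sum-homo us) (H.trans sum≈ε (H.sym ε-homo))))

  order-map : ∀ {x} → Order G x → Order H (f x)
  order-map {x} record { ord = d ; nonZero = d≢0 ; annihilates = d·x≈ε ; minimal = min } = record
    { ord         = d
    ; nonZero     = d≢0
    ; annihilates = H.trans (H.sym (·-homo d x)) (H.trans (⟦⟧-cong d·x≈ε) ε-homo)
    ; minimal     = λ m m·fx≈ε →
        min m (injective (H.trans (·-homo m x) (H.trans m·fx≈ε (H.sym ε-homo))))
    }

  orders-map : ∀ {xs} → All (Order G) xs → All (Order H) (map f xs)
  orders-map []       = []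
  orders-map (o ∷ os) = order-map o ∷ orders-map os

  k-map : ∀ {xs} (os : All (Order G) xs) → k H (orders-map os) ≡ k G os
  k-map []       = refl
  k-map (o ∷ os) rewrite k-map os = refl

k-++ : ∀ (G : Ab) {xs ys} (os : All (Order G) xs) (ps : All (Order G) ys) →
       k G (AllP.++⁺ os ps) ≡ k G os ℚ.+ k G ps
k-++ G []       ps = sym (ℚ.+-identityˡ _)
k-++ G (o ∷ os) ps rewrite k-++ G os ps = sym (ℚ.+-assoc (+ 1 ℚ./ Order.ord o) (k G os) (k G ps))

0≤k : ∀ (G : Ab) {xs} (os : All (Order G) xs) → 0ℚ ℚ.≤ k G os
0≤k G []       = ℚ.≤-refl
0≤k G (o ∷ os) = ℚ.+-mono-≤ (0≤/ (Order.ord o)) (0≤k G os)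
  where
  0≤/ : ∀ d .{{_ : NonZero d}} → 0ℚ ℚ.≤ + 1 ℚ./ d
  0≤/ d = ℚ.nonNegative⁻¹ (+ 1 ℚ./ d) {{ℚ.normalize-nonNeg 1 d}}

module _ (G : Ab) (_≈?_ : Decidable (AbelianGroup._≈_ G)) where
  open AbelianGroup G using (_≈_; ε; rawMonoid)
  open RawMonoidDefs rawMonoid using () renaming (_×_ to _·_)

  -- Linear search upwards from `d`: the third argument records that no smaller positive multiplier
  -- annihilates `x`, and `d + fuel` is known to annihilate it, so the search succeeds at the latest
  -- when the fuel is spent.
  order-above : ∀ {x} fuel d .{{_ : NonZero d}} →
                (∀ m → .{{NonZero m}} → m · x ≈ ε → d ≤ m) →
                (d ℕ.+ fuel) · x ≈ ε → Order G x
  order-above {x} zero d lower p = record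
    { ord = d ; annihilates = subst (λ e → e · x ≈ ε) (ℕ.+-identityʳ d) p ; minimal = lower }
  order-above {x} (suc fuel) d lower p with (d · x) ≈? ε
  ... | yes q = record { ord = d ; annihilates = q ; minimal = lower }
  ... | no ¬q = order-above fuel (suc d)
    (λ m q → ℕ.≤∧≢⇒< (lower m q) (λ { refl → ¬q q }))
    (subst (λ e → e · x ≈ ε) (ℕ.+-suc d fuel) p)

  order-from : ∀ {x} e .{{_ : NonZero e}} → e · x ≈ ε → Order G x
  order-from (suc e) p = order-above e 1 (λ { (suc m) _ → s≤s z≤n }) p

-- Finite direct sums of cyclic groups

small-multiple : ∀ {n m} → n ℕ.∣ m → m < n → m ≡ 0
small-multiple {m = zero}  _   _   = refl
small-multiple {m = suc m} n∣m m<n = contradiction (ℕ.∣⇒≤ n∣m) (ℕ.<⇒≱ m<n)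

residue-unique : ∀ {n a b} → a < n → b < n → + n ∣ + a ℤ.- + b → a ≡ b
residue-unique {n} {a} {b} a<n b<n n∣a-b =
  ℤ.+-injective (ℤ.i-j≡0⇒i≡j (+ a) (+ b) (ℤ.∣i∣≡0⇒i≡0 (small-multiple (ℤ.∣⇒∣ᵤ n∣a-b) bound)))
  where
  bound : ∣ + a ℤ.- + b ∣ < n
  bound rewrite ℤ.m-n≡m⊖n a b = ℕ.≤-<-trans (ℤ.∣m⊝n∣≤m⊔n a b) (ℕ.⊔-lub a<n b<n)

residue-≡ : ∀ x n .{{_ : NonZero n}} → + n ∣ x ℤ.- + (x ℤ.%ℕ n)
residue-≡ x n = divides (x ℤ./ℕ n) (begin
  x ℤ.- + (x ℤ.%ℕ n)
    ≡⟨ cong (ℤ._- + (x ℤ.%ℕ n)) (ℤ.a≡a%ℕn+[a/ℕn]*n x n) ⟩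
  + (x ℤ.%ℕ n) ℤ.+ (x ℤ./ℕ n) ℤ.* + n ℤ.- + (x ℤ.%ℕ n)
    ≡⟨ cancel (+ (x ℤ.%ℕ n)) _ ⟩
  (x ℤ./ℕ n) ℤ.* + n
    ∎)
  where
  open ≡-Reasoning
  cancel : ∀ r q → r ℤ.+ q ℤ.- r ≡ q
  cancel = solve-∀

residue-cong : ∀ {x y} n .{{_ : NonZero n}} → + n ∣ x ℤ.- y → x ℤ.%ℕ n ≡ y ℤ.%ℕ n
residue-cong {x} {y} n n∣x-y = residue-unique (ℤ.n%ℕd<d x n) (ℤ.n%ℕd<d y n)
  (Cn.trans {+ (x ℤ.%ℕ n)} {x} (Cn.sym {x} (residue-≡ x n))
    (Cn.trans {x} {y} n∣x-y (residue-≡ y n)))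
  where module Cn = AbelianGroup (C n)

residue-cancel : ∀ {x y} n .{{_ : NonZero n}} → x ℤ.%ℕ n ≡ y ℤ.%ℕ n → + n ∣ x ℤ.- y
residue-cancel {x} {y} n eq = Cn.trans {x} {+ (x ℤ.%ℕ n)} (residue-≡ x n)
  (subst (λ r → + n ∣ + r ℤ.- y) (sym eq) (Cn.sym {y} (residue-≡ y n)))
  where module Cn = AbelianGroup (C n)

C-finite : ∀ n .{{_ : NonZero n}} → Finite (C n)
C-finite n = n , record
  { to        = λ x → fromℕ< (ℤ.n%ℕd<d x n)
  ; from      = λ i → + toℕ i
  ; to-cong   = λ {x} {y} n∣x-y → Fin.fromℕ<-cong _ _ (residue-cong {x} {y} n n∣x-y) _ _
  ; from-cong = λ { {i} refl → Cn.refl {+ toℕ i} }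
  ; inverse   = (λ {i} {x} n∣x-i → Fin.toℕ-injective (trans (Fin.toℕ-fromℕ< _)
                  (residue-unique (ℤ.n%ℕd<d x n) (Fin.toℕ<n i)
                    (Cn.trans {+ (x ℤ.%ℕ n)} {x} (Cn.sym {x} (residue-≡ x n)) n∣x-i))))
              , λ { {x} refl → subst (λ r → + n ∣ + r ℤ.- x) (sym (Fin.toℕ-fromℕ< _))
                                 (Cn.sym {x} (residue-≡ x n)) }
  }
  where module Cn = AbelianGroup (C n)

⨁C-finite : ∀ {s} {ns : Vec ℕ s} → VecAll.All NonZero ns → Finite (⨁C ns)
⨁C-finite VecAll.[] = 1 , record
  { to = λ _ → zero ; from = λ _ → tt ; to-cong = λ _ → refl ; from-cong = λ _ → tt
  ; inverse = (λ { {zero} _ → refl }) , λ _ → tt }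
⨁C-finite (VecAll._∷_ {x = n} n≢0 ns≢0)
  with p , ↔p ← C-finite n {{n≢0}} | q , ↔q ← ⨁C-finite ns≢0 =
  p ℕ.* q ,
  Compose.inverse (Compose.inverse (↔p ×-inverse ↔q) Pointwise-≡↔≡) (Symmetry.inverse Fin.*↔×)

⨁C-≈? : ∀ {s} (ns : Vec ℕ s) → Decidable (AbelianGroup._≈_ (⨁C ns))
⨁C-≈? []       _       _       = yes tt
⨁C-≈? (n ∷ ns) (x , xs) (y , ys) = (+ n ℤ.∣? x ℤ.- y) ×-dec ⨁C-≈? ns xs ys

module _ (G : Ab) where
  open RawMonoidDefs (AbelianGroup.rawMonoid G) using () renaming (_×_ to infixr 8 _·_) public

·-ℤ : ∀ n m x → _·_ (C n) m x ≡ + m ℤ.* x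
·-ℤ n zero    x = refl
·-ℤ n (suc m) x = trans (cong (ℤ._+_ x) (·-ℤ n m x)) (sym (ℤ.suc-* (+ m) x))

·-pair : ∀ n {s} (ns : Vec ℕ s) m x xs →
         _·_ (⨁C (n ∷ ns)) m (x , xs) ≡ (_·_ (C n) m x , _·_ (⨁C ns) m xs)
·-pair n ns zero    x xs = refl
·-pair n ns (suc m) x xs rewrite ·-pair n ns m x xs = refl

⨁C-annihilates : ∀ {s} {ns : Vec ℕ s} {e} → VecAll.All (ℕ._∣ e) ns →
                 ∀ x → AbelianGroup._≈_ (⨁C ns) (_·_ (⨁C ns) e x) (AbelianGroup.ε (⨁C ns))
⨁C-annihilates VecAll.[] x = tt
⨁C-annihilates {ns = n ∷ ns} {e} (n∣e VecAll.∷ ns∣e) (x , xs)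
  rewrite ·-pair n ns e x xs | ·-ℤ n e x =
  subst (+ n ∣_) (sym (ℤ.+-identityʳ _)) (ℤ.∣m⇒∣m*n x (ℤ.∣ᵤ⇒∣ {+ n} {+ e} n∣e)) ,
  ⨁C-annihilates ns∣e xs

-- Provides orders for terms whose share of the cross number is only bounded below by 0. A common
-- multiple `e` of the factors makes the search for the order finite.
⨁C-order : ∀ {s} {ns : Vec ℕ s} e .{{_ : NonZero e}} → VecAll.All (ℕ._∣ e) ns →
           ∀ x → Order (⨁C ns) x
⨁C-order {ns = ns} e ns∣e x = order-from (⨁C ns) (⨁C-≈? ns) e (⨁C-annihilates ns∣e x)

-- The rank of a direct sum of cyclic groups

coord : ∀ {s} {ns : Vec ℕ s} → Fin s → AbelianGroup.Carrier (⨁C ns) → ℤ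
coord {ns = n ∷ ns} zero    (x , _)  = x
coord {ns = n ∷ ns} (suc i) (_ , xs) = coord {ns = ns} i xs

cons₀ : ∀ {s} n (ns : Vec ℕ s) → AbelianGroup.Carrier (⨁C ns) → AbelianGroup.Carrier (⨁C (n ∷ ns))
cons₀ n ns xs = 0ℤ , xs

generators : ∀ {s} (ns : Vec ℕ s) → Seq (⨁C ns)
generators []       = []
generators (n ∷ ns) = (1ℤ , AbelianGroup.ε (⨁C ns)) ∷ map (cons₀ n ns) (generators ns)

length-generators : ∀ {s} (ns : Vec ℕ s) → length (generators ns) ≡ s
length-generators []       = refl
length-generators (n ∷ ns) =
  cong suc (trans (length-map (cons₀ n ns) (generators ns)) (length-generators ns))

generators-span : ∀ {s} (ns : Vec ℕ s) → Generates (⨁C ns) (generators ns)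
generators-span []       _        = unit
generators-span (n ∷ ns) (x , xs) =
  resp (subst (λ y → + n ∣ y ℤ.- x) (sym (ℤ.+-identityʳ x)) (Cn.refl {x}) , H.identityˡ xs)
    (add (spanˡ x) (spanʳ (generators-span ns xs)))
  where
  module Cn = AbelianGroup (C n)
  module H = AbelianGroup (⨁C ns)
  gs = generators (n ∷ ns)

  spanʳ : ∀ {ys} → Span (⨁C ns) (generators ns) ys → Span (⨁C (n ∷ ns)) gs (0ℤ , ys)
  spanʳ (gen y∈)   = gen (there (∈-map⁺ (cons₀ n ns) y∈))
  spanʳ unit       = unit
  spanʳ (add p q)  = add (spanʳ p) (spanʳ q)
  spanʳ (neg p)    = neg (spanʳ p)
  spanʳ (resp e p) = resp (Cn.refl {0ℤ} , e) (spanʳ p)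

  span⁺ : ∀ m → Span (⨁C (n ∷ ns)) gs (+ m , H.ε)
  span⁺ zero    = unit
  span⁺ (suc m) = resp (Cn.refl {+ suc m} , H.identityˡ H.ε) (add (gen (here refl)) (span⁺ m))

  spanˡ : ∀ x → Span (⨁C (n ∷ ns)) gs (x , H.ε)
  spanˡ (+ m)    = span⁺ m
  spanˡ -[1+ m ] = resp
    (Cn.refl { -[1+ m ]} , H.trans (H.sym (H.identityʳ _)) (H.inverseˡ H.ε))
    (neg (span⁺ (suc m)))

module _ {s} {ns : Vec ℕ s} where
  private
    module G = AbelianGroup (⨁C ns)

  -- Coordinate `i` of Σ cⱼ gⱼ, kept as an integer so that it can be reduced modulo a common divisor
  -- of the factors.
  combination : (gs : List G.Carrier) → (Fin (length gs) → ℤ) → Fin s → ℤ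
  combination []       c i = 0ℤ
  combination (g ∷ gs) c i = c zero ℤ.* coord {ns = ns} i g ℤ.+ combination gs (c ∘ suc) i

coord-∙ : ∀ {s} (ns : Vec ℕ s) i x y → let module G = AbelianGroup (⨁C ns) in
          coord {ns = ns} i (x G.∙ y) ≡ coord {ns = ns} i x ℤ.+ coord {ns = ns} i y
coord-∙ (n ∷ ns) zero    _        _        = refl
coord-∙ (n ∷ ns) (suc i) (_ , xs) (_ , ys) = coord-∙ ns i xs ys

coord-ε : ∀ {s} (ns : Vec ℕ s) i → coord {ns = ns} i (AbelianGroup.ε (⨁C ns)) ≡ 0ℤ
coord-ε (n ∷ ns) zero    = refl
coord-ε (n ∷ ns) (suc i) = coord-ε ns i

coord-⁻¹ : ∀ {s} (ns : Vec ℕ s) i x → let module G = AbelianGroup (⨁C ns) in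
           coord {ns = ns} i (x G.⁻¹) ≡ ℤ.- coord {ns = ns} i x
coord-⁻¹ (n ∷ ns) zero    _        = refl
coord-⁻¹ (n ∷ ns) (suc i) (_ , xs) = coord-⁻¹ ns i xs

coord-cong : ∀ {s} (ns : Vec ℕ s) i {x y} → AbelianGroup._≈_ (⨁C ns) x y →
             + Vec.lookup ns i ∣ coord {ns = ns} i x ℤ.- coord {ns = ns} i y
coord-cong (n ∷ ns) zero    (p , _) = p
coord-cong (n ∷ ns) (suc i) (_ , p) = coord-cong ns i p

fromCoords : ∀ {s} (ns : Vec ℕ s) → (Fin s → ℤ) → AbelianGroup.Carrier (⨁C ns)
fromCoords []       f = tt
fromCoords (n ∷ ns) f = f zero , fromCoords ns (f ∘ suc)

coord-fromCoords : ∀ {s} (ns : Vec ℕ s) f i → coord {ns = ns} i (fromCoords ns f) ≡ f i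
coord-fromCoords (n ∷ ns) f zero    = refl
coord-fromCoords (n ∷ ns) f (suc i) = coord-fromCoords ns (f ∘ suc) i

module Rank {s} (ns : Vec ℕ s) (d : ℕ) .{{_ : NonZero d}} (d∣ns : VecAll.All (d ℕ.∣_) ns) where
  private
    module G = AbelianGroup (⨁C ns)
    module Cd = AbelianGroup (C d)
    coordᵢ = coord {ns = ns}
    combine-gs = combination {ns = ns}
    infix 4 _≡ᵈ_
    _≡ᵈ_ : ℤ → ℤ → Set
    x ≡ᵈ y = + d ∣ x ℤ.- y
    reflᵈ : ∀ {x y} → x ≡ y → x ≡ᵈ y
    reflᵈ {x} refl = Cd.refl {x}
    transᵈ : ∀ {x y z} → x ≡ᵈ y → y ≡ᵈ z → x ≡ᵈ z
    transᵈ {x} {y} {z} = Cd.trans {x} {y} {z}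

  combination-cong : ∀ gs {c c′ : Fin (length gs) → ℤ} → (∀ j → c j ≡ᵈ c′ j) →
                     ∀ i → combine-gs gs c i ≡ᵈ combine-gs gs c′ i
  combination-cong []       p i = reflᵈ {0ℤ} refl
  combination-cong (g ∷ gs) {c} {c′} p i =
    subst (+ d ∣_)
      (regroup (c zero) (c′ zero) (coordᵢ i g)
        (combine-gs gs (c ∘ suc) i) (combine-gs gs (c′ ∘ suc) i))
      (ℤ.∣m∣n⇒∣m+n (ℤ.∣m⇒∣m*n (coordᵢ i g) (p zero)) (combination-cong gs (p ∘ suc) i))
    where
    regroup : ∀ a b x u v → (a ℤ.- b) ℤ.* x ℤ.+ (u ℤ.- v) ≡ (a ℤ.* x ℤ.+ u) ℤ.- (b ℤ.* x ℤ.+ v)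
    regroup = solve-∀

  combination-0 : ∀ gs i → combine-gs gs (λ _ → 0ℤ) i ≡ 0ℤ
  combination-0 []       i = refl
  combination-0 (g ∷ gs) i = trans (ℤ.+-identityˡ _) (combination-0 gs i)

  combination-+ : ∀ gs c c′ i →
    combine-gs gs (λ j → c j ℤ.+ c′ j) i ≡ combine-gs gs c i ℤ.+ combine-gs gs c′ i
  combination-+ []       c c′ i = refl
  combination-+ (g ∷ gs) c c′ i rewrite combination-+ gs (c ∘ suc) (c′ ∘ suc) i =
    regroup (c zero) (c′ zero) (coordᵢ i g) _ _
    where
    regroup : ∀ a b x u v → (a ℤ.+ b) ℤ.* x ℤ.+ (u ℤ.+ v) ≡ (a ℤ.* x ℤ.+ u) ℤ.+ (b ℤ.* x ℤ.+ v)
    regroup = solve-∀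

  combination-neg : ∀ gs c i → combine-gs gs (λ j → ℤ.- c j) i ≡ ℤ.- combine-gs gs c i
  combination-neg []       c i = refl
  combination-neg (g ∷ gs) c i rewrite combination-neg gs (c ∘ suc) i =
    regroup (c zero) (coordᵢ i g) _
    where
    regroup : ∀ a x u → (ℤ.- a) ℤ.* x ℤ.+ (ℤ.- u) ≡ ℤ.- (a ℤ.* x ℤ.+ u)
    regroup = solve-∀

  combination-∈ : ∀ {gs g} → g ∈ gs → ∃[ c ] ∀ i → coordᵢ i g ≡ combine-gs gs c i
  combination-∈ {g ∷ gs} (here refl) = (λ { zero → 1ℤ ; (suc _) → 0ℤ }) , λ i →
    sym (trans (cong₂ ℤ._+_ (ℤ.*-identityˡ (coordᵢ i g)) (combination-0 gs i)) (ℤ.+-identityʳ _))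
  combination-∈ {g ∷ gs} (there g∈) with c , eq ← combination-∈ g∈ =
    (λ { zero → 0ℤ ; (suc j) → c j }) , λ i → trans (eq i) (sym (ℤ.+-identityˡ _))

  -- Congruence modulo `d` is what survives all constructors of `Span`: `resp` may change a
  -- coordinate by a multiple of its factor, and `d` divides every factor.
  span-combination : ∀ {gs x} → Span (⨁C ns) gs x →
                     ∃[ c ] ∀ i → coordᵢ i x ≡ᵈ combine-gs gs c i
  span-combination (gen x∈) with c , eq ← combination-∈ x∈ = c , λ i → reflᵈ (eq i)
  span-combination {gs} unit =
    (λ _ → 0ℤ) , λ i → reflᵈ (trans (coord-ε ns i) (sym (combination-0 gs i)))
  span-combination {gs} (add {x} {y} p q)
    with c , eq ← span-combination p | c′ , eq′ ← span-combination q =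
    (λ j → c j ℤ.+ c′ j) , λ i →
      subst₂ _≡ᵈ_ (sym (coord-∙ ns i x y)) (sym (combination-+ gs c c′ i))
        (Cd.∙-cong {coordᵢ i x} {combine-gs gs c i} {coordᵢ i y} (eq i) (eq′ i))
  span-combination {gs} (neg {x} p) with c , eq ← span-combination p =
    (λ j → ℤ.- c j) , λ i →
      subst₂ _≡ᵈ_ (sym (coord-⁻¹ ns i x)) (sym (combination-neg gs c i))
        (Cd.⁻¹-cong {coordᵢ i x} (eq i))
  span-combination {gs} (resp {x} {y} x≈y p) with c , eq ← span-combination p =
    c , λ i → transᵈ {coordᵢ i y} {coordᵢ i x}
      (Cd.sym {coordᵢ i x}
        (ℤ.∣-trans (ℤ.∣ᵤ⇒∣ (VecAllP.lookup⁺ d∣ns i)) (coord-cong ns i {x} {y} x≈y)))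
      (eq i)

  funToFin-cong : ∀ {m n} {f g : Fin m → Fin n} → (∀ i → f i ≡ g i) → funToFin f ≡ funToFin g
  funToFin-cong {zero}  f≗g = refl
  funToFin-cong {suc m} f≗g = cong₂ combine (f≗g zero) (funToFin-cong (f≗g ∘ suc))

  -- Over ℤ / d, distinct points need distinct coefficient vectors, so d ^ s ≤ d ^ length gs.
  rank-lower : 1 < d → ∀ gs → Generates (⨁C ns) gs → s ≤ length gs
  rank-lower 1<d gs generates = ℕ.≮⇒≥ λ l<s →
    ℕ.<⇒≱ (ℕ.^-monoʳ-< d 1<d l<s) (Fin.injective⇒≤ encode-injective)
    where
    -- The coordinates are the base-`d` digits of `v`; lying below `d`, they are determined by their
    -- classes modulo `d`.
    point : Fin (d ℕ.^ s) → G.Carrier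
    point v = fromCoords ns (λ i → + toℕ (finToFun v i))

    coefficients : Fin (d ℕ.^ s) → Fin (length gs) → ℤ
    coefficients v = proj₁ (span-combination (generates (point v)))

    residues : Fin (d ℕ.^ s) → Fin (length gs) → Fin d
    residues v j = fromℕ< (ℤ.n%ℕd<d (coefficients v j) d)

    encode : Fin (d ℕ.^ s) → Fin (d ℕ.^ length gs)
    encode v = funToFin (residues v)

    encode-injective : ∀ {v w} → encode v ≡ encode w → v ≡ w
    encode-injective {v} {w} eq =
      trans (sym (Fin.funToFin-finToFin {s} {d} v))
        (trans (funToFin-cong digits) (Fin.funToFin-finToFin {s} {d} w))
      where
      residues-≡ : ∀ j → residues v j ≡ residues w j
      residues-≡ j = trans (sym (Fin.finToFun-funToFin (residues v) j))
        (trans (cong (λ u → finToFun u j) eq) (Fin.finToFun-funToFin (residues w) j))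
      coefficients-≡ : ∀ j → coefficients v j ≡ᵈ coefficients w j
      coefficients-≡ j = residue-cancel {coefficients v j} d
        (trans (sym (Fin.toℕ-fromℕ< _)) (trans (cong toℕ (residues-≡ j)) (Fin.toℕ-fromℕ< _)))
      digits : ∀ i → finToFun {d} {s} v i ≡ finToFun {d} {s} w i
      digits i = Fin.toℕ-injective (residue-unique (Fin.toℕ<n (finToFun v i)) (Fin.toℕ<n (finToFun w i))
        (subst₂ _≡ᵈ_ (coord-fromCoords ns _ i) (coord-fromCoords ns _ i)
          (transᵈ {x v} {y v} (eqᵛ v) (transᵈ {y v} {y w} (combination-cong gs coefficients-≡ i)
            (Cd.sym {x w} (eqᵛ w))))))
        where
        x y : Fin (d ℕ.^ s) → ℤ
        x u = coordᵢ i (point u)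
        y u = combine-gs gs (coefficients u) i
        eqᵛ : ∀ u → x u ≡ᵈ y u
        eqᵛ u = proj₂ (span-combination (generates (point u))) i

  rank : 1 < d → HasRank (⨁C ns) s
  rank 1<d = (generators ns , length-generators ns , generators-span ns) , rank-lower 1<d

-- Sequences over cyclic groups with large cross number

sum-replicate : ∀ (G : Ab) c x → sum G (replicate c x) ≡ _·_ G c x
sum-replicate G zero    x = refl
sum-replicate G (suc c) x = cong (AbelianGroup._∙_ G x) (sum-replicate G c x)

zeroSumFree-replicate : ∀ (G : Ab) {x} (o : Order G x) {m} → m < Order.ord o →
                        ZeroSumFree G (replicate m x)
zeroSumFree-replicate G {x} o {m} m<ord zs zs⊆ zs≢[] sum≈ε with ⊆-replicate m zs⊆
... | zero  , _   , refl = zs≢[] refl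
... | suc c , c<m , refl = ℕ.<⇒≱ (ℕ.≤-<-trans c<m m<ord)
  (Order.minimal o (suc c)
    (subst (λ y → AbelianGroup._≈_ G y (AbelianGroup.ε G)) (sum-replicate G (suc c) x) sum≈ε))

·≈0⇒∣ : ∀ n m a → AbelianGroup._≈_ (C n) (_·_ (C n) m (+ a)) 0ℤ → n ℕ.∣ m ℕ.* a
·≈0⇒∣ n m a p rewrite ·-ℤ n m (+ a) | ℤ.+-identityʳ (+ m ℤ.* + a) | sym (ℤ.pos-* m a) = ℤ.∣⇒∣ᵤ p

∣⇒·≈0 : ∀ n m a → n ℕ.∣ m ℕ.* a → AbelianGroup._≈_ (C n) (_·_ (C n) m (+ a)) 0ℤ
∣⇒·≈0 n m a p rewrite ·-ℤ n m (+ a) | ℤ.+-identityʳ (+ m ℤ.* + a) | sym (ℤ.pos-* m a) =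
  ℤ.∣ᵤ⇒∣ {+ n} p

C-order : ∀ n a d .{{_ : NonZero d}} →
          n ℕ.∣ d ℕ.* a → (∀ m → n ℕ.∣ m ℕ.* a → d ℕ.∣ m) → Order (C n) (+ a)
C-order n a d n∣d*a d∣ = record
  { ord         = d
  ; annihilates = ∣⇒·≈0 n d a n∣d*a
  ; minimal     = λ m p → ℕ.∣⇒≤ (d∣ m (·≈0⇒∣ n m a p))
  }

C-order-1 : ∀ n .{{_ : NonZero n}} → Order (C n) 1ℤ
C-order-1 n = C-order n 1 n (ℕ.m∣m*n 1) (λ m → subst (n ℕ.∣_) (ℕ.*-identityʳ m))

-- Fractions in `ℚ` are stored in lowest terms, so the identity is verified on unnormalised
-- representatives, where it is polynomial.
1/d+m/d : ∀ d .{{_ : NonZero d}} m → (+ 1 ℚ./ d) ℚ.+ (+ m ℚ./ d) ≡ + suc m ℚ./ d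
1/d+m/d d@(suc d-1) m = ℚ.toℚᵘ-injective (begin
  ℚ.toℚᵘ ((+ 1 ℚ./ d) ℚ.+ (+ m ℚ./ d))
    ≈⟨ ℚ.toℚᵘ-homo-+ (+ 1 ℚ./ d) (+ m ℚ./ d) ⟩
  ℚ.toℚᵘ (+ 1 ℚ./ d) ℚᵘ.+ ℚ.toℚᵘ (+ m ℚ./ d)
    ≈⟨ ℚᵘ.+-cong
         (ℚ.toℚᵘ-fromℚᵘ (ℚᵘ.mkℚᵘ (+ 1) d-1))
         (ℚ.toℚᵘ-fromℚᵘ (ℚᵘ.mkℚᵘ (+ m) d-1)) ⟩
  ℚᵘ.mkℚᵘ (+ 1) d-1 ℚᵘ.+ ℚᵘ.mkℚᵘ (+ m) d-1
    ≈⟨ ℚᵘ.*≡* (trans (regroup (+ m) (+ d))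
         (cong ((1ℤ ℤ.+ + m) ℤ.*_) (sym (ℤ.pos-* d d)))) ⟩
  ℚᵘ.mkℚᵘ (+ suc m) d-1
    ≈⟨ ℚ.toℚᵘ-fromℚᵘ (ℚᵘ.mkℚᵘ (+ suc m) d-1) ⟨
  ℚ.toℚᵘ (+ suc m ℚ./ d)
    ∎)
  where
  open import Relation.Binary.Reasoning.Setoid ℚᵘ.≃-setoid
  regroup : ∀ m d → (1ℤ ℤ.* d ℤ.+ m ℤ.* d) ℤ.* d ≡ (1ℤ ℤ.+ m) ℤ.* (d ℤ.* d)
  regroup = solve-∀

/-mono-≤ : ∀ {a b c d} .{{_ : NonZero b}} .{{_ : NonZero d}} →
           a ℕ.* d ≤ c ℕ.* b → + a ℚ./ b ℚ.≤ + c ℚ./ d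
/-mono-≤ {a} {b@(suc b-1)} {c} {d@(suc d-1)} ad≤cb = ℚ.toℚᵘ-cancel-≤
  (ℚᵘ.≤-respˡ-≃ (ℚᵘ.≃-sym (ℚ.toℚᵘ-fromℚᵘ (ℚᵘ.mkℚᵘ (+ a) b-1)))
    (ℚᵘ.≤-respʳ-≃ (ℚᵘ.≃-sym (ℚ.toℚᵘ-fromℚᵘ (ℚᵘ.mkℚᵘ (+ c) d-1)))
      (ℚᵘ.*≤* (subst₂ ℤ._≤_ (ℤ.pos-* a d) (ℤ.pos-* c b) (ℤ.+≤+ ad≤cb)))))

k-replicate : ∀ (G : Ab) {x} (o : Order G x) m →
              k G (AllP.replicate⁺ m o) ≡ + m ℚ./ Order.ord o
k-replicate G o zero    = sym (0/ (Order.ord o))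
  where
  0/ : ∀ d .{{_ : NonZero d}} → + 0 ℚ./ d ≡ 0ℚ
  0/ d = ℚ.0/n≡0 d
k-replicate G o (suc m) rewrite k-replicate G o m = 1/d+m/d (Order.ord o) m

-- 2, 6, 42, 1806, ...: Sylvester's numbers 3, 7, 43, 1807, ... diminished by 1.
pronic : ℕ → ℕ
pronic zero    = 2
pronic (suc m) = pronic m ℕ.* suc (pronic m)

1<pronic : ∀ m → 1 < pronic m
1<pronic zero    = ℕ.≤-refl
1<pronic (suc m) = ℕ.≤-trans (1<pronic m) (ℕ.m≤m*n (pronic m) (suc (pronic m)))

pronic-nonZero : ∀ m → NonZero (pronic m)
pronic-nonZero m = ℕ.>-nonZero (ℕ.<-trans ℕ.z<s (1<pronic m))

module PronicStep (N : ℕ) .{{_ : NonZero N}} where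
  M = N ℕ.* suc N

  -- Embeds C_N into C_M with image the multiples of `suc N`, which form the kernel of the reduction
  -- `reduce-hom`.
  dilate : ℤ → ℤ
  dilate x = + suc N ℤ.* x

  dilate-mono : IsMonoidMonomorphism (C N) (C M) dilate
  dilate-mono = record
    { isMonoidHomomorphism = monoidHom (C N) (C M) dilate
        (λ {x} {y} p → subst₂ _∣_ M≡ (distrib (+ suc N) x y) (ℤ.*-monoʳ-∣ (+ suc N) p))
        (λ x y → ≡⇒≈ (ℤ.*-distribˡ-+ (+ suc N) x y))
        (≡⇒≈ (ℤ.*-zeroʳ (+ suc N)))
    ; injective = λ {x} {y} p →
        ℤ.*-cancelˡ-∣ (+ suc N) (subst₂ _∣_ (sym M≡) (sym (distrib (+ suc N) x y)) p)
    }
    where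
    ≡⇒≈ : ∀ {x y} → x ≡ y → + M ∣ x ℤ.- y
    ≡⇒≈ {x} refl = AbelianGroup.refl (C M) {x}
    M≡ : + suc N ℤ.* + N ≡ + M
    M≡ = trans (sym (ℤ.pos-* (suc N) N)) (cong +_ (ℕ.*-comm (suc N) N))
    distrib : ∀ a x y → a ℤ.* (x ℤ.- y) ≡ a ℤ.* x ℤ.- a ℤ.* y
    distrib = solve-∀

  reduce-hom : IsMonoidHomomorphism (C M) (C (suc N)) id
  reduce-hom = monoidHom (C M) (C (suc N)) id
    (λ p → ℤ.∣-trans (ℤ.∣ᵤ⇒∣ {+ suc N} {+ M} (ℕ.n∣m*n N)) p)
    (λ x y → AbelianGroup.refl (C (suc N)) {x ℤ.+ y})
    (AbelianGroup.refl (C (suc N)) {0ℤ})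

  order-N : Order (C M) (+ N)
  order-N = C-order M N (suc N) (ℕ.∣-reflexive (ℕ.*-comm N (suc N)))
    (λ m p → ℕ.*-cancelʳ-∣ N (subst (ℕ._∣ m ℕ.* N) (ℕ.*-comm N (suc N)) p))

  -- `N` is -1 modulo `suc N`: if `suc N` divides `m * N`, it divides `m`, since the two add up to
  -- `m * suc N`.
  order-N-mod : Order (C (suc N)) (+ N)
  order-N-mod = C-order (suc N) N (suc N) (ℕ.m∣m*n N) (λ m p → ℕ.∣m+n∣m⇒∣n
    (subst (suc N ℕ.∣_) (trans (ℕ.*-suc m N) (ℕ.+-comm m (m ℕ.* N))) (ℕ.n∣m*n m)) p)

  -- Reduction modulo `suc N` kills the dilated terms, and there `N` has order `suc N`, so its `N`
  -- copies stay one short of a zero sum.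
  zeroSumFree-step : ∀ {xs} → ZeroSumFree (C N) xs →
                     ZeroSumFree (C M) (map dilate xs ++ replicate N (+ N))
  zeroSumFree-step {xs} zsf = Hom.zeroSumFree-extension (C M) (C (suc N)) reduce-hom
    (Mono.zeroSumFree-map (C N) (C M) dilate-mono zsf)
    (subst (ZeroSumFree (C (suc N))) (sym (map-replicate id N (+ N)))
      (zeroSumFree-replicate (C (suc N)) order-N-mod ℕ.≤-refl))
    (AllP.map⁺ (All.universal (λ x →
      subst (+ suc N ∣_) (sym (ℤ.+-identityʳ _)) (ℤ.∣m⇒∣m*n x ℤ.∣-refl)) xs))

  orders-step : ∀ {xs} → All (Order (C N)) xs → All (Order (C M)) (map dilate xs ++ replicate N (+ N))
  orders-step os = AllP.++⁺ (Mono.orders-map (C N) (C M) dilate-mono os) (AllP.replicate⁺ N order-N)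

  k-step : ∀ {xs} (os : All (Order (C N)) xs) →
           k (C M) (orders-step os) ≡ k (C N) os ℚ.+ + N ℚ./ suc N
  k-step os = trans (k-++ (C M) (Mono.orders-map (C N) (C M) dilate-mono os) (AllP.replicate⁺ N order-N))
    (cong₂ ℚ._+_ (Mono.k-map (C N) (C M) dilate-mono os) (k-replicate (C M) order-N N))

-- The sequence `T`. Its cross number gains at least 1/2 with each step of `pronic`, whence the
-- value m / 2 in `k≥`; `short` later guarantees that the total length can be met by adjusting a
-- single multiplicity.
record Heavy (m : ℕ) : Set where
  field
    seq         : Seq (C (pronic m))
    zeroSumFree : ZeroSumFree (C (pronic m)) seq
    short       : length seq < pronic m
    orders      : All (Order (C (pronic m))) seq
    k≥          : + m ℚ./ 2 ℚ.≤ k (C (pronic m)) orders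

heavy : ∀ m → Heavy m
heavy zero = record
  { seq         = []
  ; zeroSumFree = λ { [] [] []≢[] _ → []≢[] refl }
  ; short       = s≤s z≤n
  ; orders      = []
  ; k≥          = ℚ.≤-refl
  }
heavy (suc m) = record
  { seq         = map dilate H.seq ++ replicate N (+ N)
  ; zeroSumFree = zeroSumFree-step H.zeroSumFree
  ; short       = short
  ; orders      = orders-step H.orders
  ; k≥          = subst₂ ℚ._≤_
      (trans (ℚ.+-comm (+ m ℚ./ 2) (+ 1 ℚ./ 2)) (1/d+m/d 2 m)) (sym (k-step H.orders))
      (ℚ.+-mono-≤ H.k≥ (/-mono-≤ {1} {2} {N} {suc N} bound))
  }
  where
  module H = Heavy (heavy m)
  N = pronic m
  instance
    N≢0 : NonZero N
    N≢0 = pronic-nonZero m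
  open PronicStep N
  -- The inequality 1/2 ≤ N / (N + 1) with denominators cleared.
  bound : 1 ℕ.* suc N ≤ N ℕ.* 2
  bound = begin
    1 ℕ.* suc N  ≡⟨ ℕ.*-identityˡ (suc N) ⟩
    1 ℕ.+ N      ≤⟨ ℕ.+-monoˡ-≤ N (ℕ.<⇒≤ (1<pronic m)) ⟩
    N ℕ.+ N      ≡⟨ cong (N ℕ.+_) (ℕ.+-identityʳ N) ⟨
    2 ℕ.* N      ≡⟨ ℕ.*-comm 2 N ⟩
    N ℕ.* 2      ∎
    where open ℕ.≤-Reasoning
  short : length (map dilate H.seq ++ replicate N (+ N)) < M
  short rewrite length-++ (map dilate H.seq) {replicate N (+ N)} | length-map dilate H.seq
              | length-replicate N {+ N} = begin-strict
    length H.seq ℕ.+ N  <⟨ ℕ.+-monoˡ-< N H.short ⟩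
    N ℕ.+ N             ≤⟨ ℕ.+-monoʳ-≤ N (ℕ.m≤m*n N N) ⟩
    N ℕ.+ N ℕ.* N       ≡⟨ ℕ.*-suc N N ⟨
    M                   ∎
    where open ℕ.≤-Reasoning

-- The zero-sum free sequence of length d* + n

blocks : ∀ {A : Set} {t} → Vec A t → Vec ℕ t → List A
blocks []       []       = []
blocks (x ∷ xs) (m ∷ ms) = replicate m x ++ blocks xs ms

length-blocks : ∀ {A : Set} {t} (xs : Vec A t) ms → length (blocks xs ms) ≡ Vec.sum ms
length-blocks []       []       = refl
length-blocks (x ∷ xs) (m ∷ ms) = trans (length-++ (replicate m x))
  (cong₂ ℕ._+_ (length-replicate m) (length-blocks xs ms))

-- Replaces a subsequence by its vector of multiplicities, so that zero-sum freeness becomes a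
-- question about the lattice points between 0 and `ms`.
⊆-blocks : ∀ {A : Set} {t} (xs : Vec A t) ms {zs} → zs ⊆ blocks xs ms →
           ∃[ cs ] Pointwise _≤_ cs ms × zs ≡ blocks xs cs
⊆-blocks []       []       []  = [] , [] , refl
⊆-blocks (x ∷ xs) (m ∷ ms) zs⊆
  with us , vs , us⊆ , vs⊆ , refl ← ⊆-++-split (replicate m x) zs⊆
  with c , c≤m , refl ← ⊆-replicate m us⊆ | cs , cs≤ms , refl ← ⊆-blocks xs ms vs⊆ =
  c ∷ cs , c≤m ∷ cs≤ms , refl

element : ∀ {s} (ns : Vec ℕ s) → Vec ℕ s → AbelianGroup.Carrier (⨁C ns)
element ns w = fromCoords ns (λ i → + lookup w i)

-- Entry `i` of the product of the row vector `cs` with the matrix whose rows are `ws`.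
weight : ∀ {s t} → Vec (Vec ℕ s) t → Vec ℕ t → Fin s → ℕ
weight []       []       i = 0
weight (w ∷ ws) (c ∷ cs) i = c ℕ.* lookup w i ℕ.+ weight ws cs i

module _ {s} (ns : Vec ℕ s) where
  private
    module G = AbelianGroup (⨁C ns)
    coordᵢ = coord {ns = ns}

  coord-replicate : ∀ m w ys i → coordᵢ i (sum (⨁C ns) (replicate m (element ns w) ++ ys)) ≡
                    + (m ℕ.* lookup w i) ℤ.+ coordᵢ i (sum (⨁C ns) ys)
  coord-replicate zero    w ys i = sym (ℤ.+-identityˡ _)
  coord-replicate (suc m) w ys i = begin
    coordᵢ i (element ns w G.∙ sum (⨁C ns) (replicate m (element ns w) ++ ys))
      ≡⟨ coord-∙ ns i _ _ ⟩
    coordᵢ i (element ns w) ℤ.+ coordᵢ i (sum (⨁C ns) (replicate m (element ns w) ++ ys))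
      ≡⟨ cong₂ ℤ._+_ (coord-fromCoords ns _ i) (coord-replicate m w ys i) ⟩
    + lookup w i ℤ.+ (+ (m ℕ.* lookup w i) ℤ.+ coordᵢ i (sum (⨁C ns) ys))
      ≡⟨ ℤ.+-assoc (+ lookup w i) (+ (m ℕ.* lookup w i)) (coordᵢ i (sum (⨁C ns) ys)) ⟨
    + (suc m ℕ.* lookup w i) ℤ.+ coordᵢ i (sum (⨁C ns) ys) ∎
    where open ≡-Reasoning

  coord-blocks : ∀ {t} (ws : Vec (Vec ℕ s) t) cs i →
                 coordᵢ i (sum (⨁C ns) (blocks (Vec.map (element ns) ws) cs)) ≡ + weight ws cs i
  coord-blocks []       []       i = coord-ε ns i
  coord-blocks (w ∷ ws) (c ∷ cs) i = trans (coord-replicate c w _ i)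
    (cong (ℤ._+_ (+ (c ℕ.* lookup w i))) (coord-blocks ws cs i))

  -- Leaves the group for plain divisibility in ℕ, with one condition for each factor.
  blocks≈ε⇒∣weight : ∀ {t} (ws : Vec (Vec ℕ s) t) cs →
    sum (⨁C ns) (blocks (Vec.map (element ns) ws) cs) G.≈ G.ε →
    ∀ i → lookup ns i ℕ.∣ weight ws cs i
  blocks≈ε⇒∣weight ws cs sum≈ε i =
    ℤ.∣⇒∣ᵤ (subst (+ lookup ns i ℤ.∣_) eq (coord-cong ns i {y = G.ε} sum≈ε))
    where
    eq : coordᵢ i (sum (⨁C ns) (blocks (Vec.map (element ns) ws) cs)) ℤ.- coordᵢ i G.ε ≡
         + weight ws cs i
    eq rewrite coord-ε ns i | coord-blocks ws cs i = ℤ.+-identityʳ _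

-- The elementary divisors 1, 1, 1, 2, 2, 2, 2, 6 of Λ in ℤ⁸, multiplied by `n`; the three units
-- reflect that eight terms generate a group K of rank 5.
coreFactors : ℕ → Vec ℕ 8
coreFactors n = n ∷ n ∷ n ∷ 2 ℕ.* n ∷ 2 ℕ.* n ∷ 2 ℕ.* n ∷ 2 ℕ.* n ∷ 6 ℕ.* n ∷ []

-- Row I, for I = 1, 2, 3, 12, 13, 23, 123, is a lift of (1_I, 0, 1), and the last row is a
-- lift of (0, 1, 2): columns 3-5 are the C₂³-part, columns 6 and 7 the parts in C₂ and C₆.
-- Columns 0-2 make the matrix unimodular, which identifies ⨁C (coreFactors n) with ℤ⁸ / nΛ.
coreWeights : Vec (Vec ℕ 8) 8
coreWeights =
  (0 ∷ 0 ∷ 0 ∷ 1 ∷ 0 ∷ 0 ∷ 0 ∷ 1 ∷ []) ∷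
  (0 ∷ 0 ∷ 0 ∷ 0 ∷ 1 ∷ 0 ∷ 0 ∷ 1 ∷ []) ∷
  (0 ∷ 0 ∷ 0 ∷ 0 ∷ 0 ∷ 1 ∷ 0 ∷ 1 ∷ []) ∷
  (0 ∷ 0 ∷ 0 ∷ 1 ∷ 1 ∷ 0 ∷ 0 ∷ 1 ∷ []) ∷
  (1 ∷ 0 ∷ 0 ∷ 1 ∷ 0 ∷ 1 ∷ 0 ∷ 1 ∷ []) ∷
  (0 ∷ 1 ∷ 0 ∷ 0 ∷ 1 ∷ 1 ∷ 0 ∷ 1 ∷ []) ∷
  (0 ∷ 0 ∷ 1 ∷ 1 ∷ 1 ∷ 1 ∷ 0 ∷ 1 ∷ []) ∷
  (0 ∷ 0 ∷ 0 ∷ 0 ∷ 0 ∷ 0 ∷ 1 ∷ 2 ∷ []) ∷ []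

-- The multiplicities are those of K, that of (0, 1, 2) being written 2θ since it is even.
Balanced : (α β γ δ ε ζ η θ : Fin 2) → Set
Balanced α β γ δ ε ζ η θ =
  2 ℕ.∣ toℕ α ℕ.+ toℕ δ ℕ.+ toℕ ε ℕ.+ toℕ η ×
  2 ℕ.∣ toℕ β ℕ.+ toℕ δ ℕ.+ toℕ ζ ℕ.+ toℕ η ×
  2 ℕ.∣ toℕ γ ℕ.+ toℕ ε ℕ.+ toℕ ζ ℕ.+ toℕ η ×
  6 ℕ.∣ toℕ α ℕ.+ toℕ β ℕ.+ toℕ γ ℕ.+ toℕ δ ℕ.+ toℕ ε ℕ.+ toℕ ζ ℕ.+ toℕ η ℕ.+ 4 ℕ.* toℕ θ

balanced? : ∀ α β γ δ ε ζ η θ → Dec (Balanced α β γ δ ε ζ η θ)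
balanced? α β γ δ ε ζ η θ = (2 ℕ.∣? _) ×-dec (2 ℕ.∣? _) ×-dec (2 ℕ.∣? _) ×-dec (6 ℕ.∣? _)

-- Zero-sum freeness over K, decided by running through all 256 cases. By hand: the first three
-- conditions make the chosen vectors v sum to 0 in C₂³, which is possible only for 0, 3, 4 or 7 of
-- the seven nonzero vectors; adding 0 or 4 to these numbers gives a multiple of 6 only as 0 + 0.
balanced⇒0 : ∀ α β γ δ ε ζ η θ → Balanced α β γ δ ε ζ η θ →
             α ∷ β ∷ γ ∷ δ ∷ ε ∷ ζ ∷ η ∷ θ ∷ [] ≡ Vec.replicate 8 0F
balanced⇒0 = from-yes (Fin.all? λ α → Fin.all? λ β → Fin.all? λ γ → Fin.all? λ δ →
  Fin.all? λ ε → Fin.all? λ ζ → Fin.all? λ η → Fin.all? λ θ →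
  balanced? α β γ δ ε ζ η θ →-dec
  Vec.≡-dec Fin._≟_ (α ∷ β ∷ γ ∷ δ ∷ ε ∷ ζ ∷ η ∷ θ ∷ []) (Vec.replicate 8 0F))

quotient<2 : ∀ {m n} .{{_ : NonZero n}} (n∣m : n ℕ.∣ m) → m < 2 ℕ.* n →
             Σ[ i ∈ Fin 2 ] m ≡ toℕ i ℕ.* n
quotient<2 {m} {n} (ℕ.divides q refl) m<2n =
  fromℕ< q<2 , cong (ℕ._* n) (sym (Fin.toℕ-fromℕ< q<2))
  where q<2 = ℕ.*-cancelʳ-< n q 2 m<2n

∣-+ˡ : ∀ {d} m {n} → d ℕ.∣ m ℕ.+ n → d ℕ.∣ n → d ℕ.∣ m
∣-+ˡ {d} m {n} p q = ℕ.∣m+n∣m⇒∣n (subst (d ℕ.∣_) (ℕ.+-comm m n) p) q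

-- The ring solver does not unfold weight, hence the explicit sums.
weight₀ : ∀ a b c d e f g h →
          weight coreWeights (a ∷ b ∷ c ∷ d ∷ e ∷ f ∷ g ∷ h ∷ []) 0F ≡
          e
weight₀ a b c d e f g h = unfolded a b c d e f g h
  where
  unfolded : ∀ a b c d e f g h →
    a ℕ.* 0 ℕ.+ (b ℕ.* 0 ℕ.+ (c ℕ.* 0 ℕ.+ (d ℕ.* 0 ℕ.+
      (e ℕ.* 1 ℕ.+ (f ℕ.* 0 ℕ.+ (g ℕ.* 0 ℕ.+ (h ℕ.* 0 ℕ.+ 0))))))) ≡
    e
  unfolded = ℕ.solve-∀

weight₁ : ∀ a b c d e f g h →
          weight coreWeights (a ∷ b ∷ c ∷ d ∷ e ∷ f ∷ g ∷ h ∷ []) 1F ≡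
          f
weight₁ a b c d e f g h = unfolded a b c d e f g h
  where
  unfolded : ∀ a b c d e f g h →
    a ℕ.* 0 ℕ.+ (b ℕ.* 0 ℕ.+ (c ℕ.* 0 ℕ.+ (d ℕ.* 0 ℕ.+
      (e ℕ.* 0 ℕ.+ (f ℕ.* 1 ℕ.+ (g ℕ.* 0 ℕ.+ (h ℕ.* 0 ℕ.+ 0))))))) ≡
    f
  unfolded = ℕ.solve-∀

weight₂ : ∀ a b c d e f g h →
          weight coreWeights (a ∷ b ∷ c ∷ d ∷ e ∷ f ∷ g ∷ h ∷ []) 2F ≡
          g
weight₂ a b c d e f g h = unfolded a b c d e f g h
  where
  unfolded : ∀ a b c d e f g h →
    a ℕ.* 0 ℕ.+ (b ℕ.* 0 ℕ.+ (c ℕ.* 0 ℕ.+ (d ℕ.* 0 ℕ.+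
      (e ℕ.* 0 ℕ.+ (f ℕ.* 0 ℕ.+ (g ℕ.* 1 ℕ.+ (h ℕ.* 0 ℕ.+ 0))))))) ≡
    g
  unfolded = ℕ.solve-∀

weight₃ : ∀ a b c d e f g h →
          weight coreWeights (a ∷ b ∷ c ∷ d ∷ e ∷ f ∷ g ∷ h ∷ []) 3F ≡
          a ℕ.+ d ℕ.+ e ℕ.+ g
weight₃ a b c d e f g h = unfolded a b c d e f g h
  where
  unfolded : ∀ a b c d e f g h →
    a ℕ.* 1 ℕ.+ (b ℕ.* 0 ℕ.+ (c ℕ.* 0 ℕ.+ (d ℕ.* 1 ℕ.+
      (e ℕ.* 1 ℕ.+ (f ℕ.* 0 ℕ.+ (g ℕ.* 1 ℕ.+ (h ℕ.* 0 ℕ.+ 0))))))) ≡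
    a ℕ.+ d ℕ.+ e ℕ.+ g
  unfolded = ℕ.solve-∀

weight₄ : ∀ a b c d e f g h →
          weight coreWeights (a ∷ b ∷ c ∷ d ∷ e ∷ f ∷ g ∷ h ∷ []) 4F ≡
          b ℕ.+ d ℕ.+ f ℕ.+ g
weight₄ a b c d e f g h = unfolded a b c d e f g h
  where
  unfolded : ∀ a b c d e f g h →
    a ℕ.* 0 ℕ.+ (b ℕ.* 1 ℕ.+ (c ℕ.* 0 ℕ.+ (d ℕ.* 1 ℕ.+
      (e ℕ.* 0 ℕ.+ (f ℕ.* 1 ℕ.+ (g ℕ.* 1 ℕ.+ (h ℕ.* 0 ℕ.+ 0))))))) ≡
    b ℕ.+ d ℕ.+ f ℕ.+ g
  unfolded = ℕ.solve-∀

weight₅ : ∀ a b c d e f g h →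
          weight coreWeights (a ∷ b ∷ c ∷ d ∷ e ∷ f ∷ g ∷ h ∷ []) 5F ≡
          c ℕ.+ e ℕ.+ f ℕ.+ g
weight₅ a b c d e f g h = unfolded a b c d e f g h
  where
  unfolded : ∀ a b c d e f g h →
    a ℕ.* 0 ℕ.+ (b ℕ.* 0 ℕ.+ (c ℕ.* 1 ℕ.+ (d ℕ.* 0 ℕ.+
      (e ℕ.* 1 ℕ.+ (f ℕ.* 1 ℕ.+ (g ℕ.* 1 ℕ.+ (h ℕ.* 0 ℕ.+ 0))))))) ≡
    c ℕ.+ e ℕ.+ f ℕ.+ g
  unfolded = ℕ.solve-∀

weight₆ : ∀ a b c d e f g h →
          weight coreWeights (a ∷ b ∷ c ∷ d ∷ e ∷ f ∷ g ∷ h ∷ []) 6F ≡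
          h
weight₆ a b c d e f g h = unfolded a b c d e f g h
  where
  unfolded : ∀ a b c d e f g h →
    a ℕ.* 0 ℕ.+ (b ℕ.* 0 ℕ.+ (c ℕ.* 0 ℕ.+ (d ℕ.* 0 ℕ.+
      (e ℕ.* 0 ℕ.+ (f ℕ.* 0 ℕ.+ (g ℕ.* 0 ℕ.+ (h ℕ.* 1 ℕ.+ 0))))))) ≡
    h
  unfolded = ℕ.solve-∀

weight₇ : ∀ a b c d e f g h →
          weight coreWeights (a ∷ b ∷ c ∷ d ∷ e ∷ f ∷ g ∷ h ∷ []) 7F ≡
          a ℕ.+ b ℕ.+ c ℕ.+ d ℕ.+ e ℕ.+ f ℕ.+ g ℕ.+ 2 ℕ.* h
weight₇ a b c d e f g h = unfolded a b c d e f g h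
  where
  unfolded : ∀ a b c d e f g h →
    a ℕ.* 1 ℕ.+ (b ℕ.* 1 ℕ.+ (c ℕ.* 1 ℕ.+ (d ℕ.* 1 ℕ.+
      (e ℕ.* 1 ℕ.+ (f ℕ.* 1 ℕ.+ (g ℕ.* 1 ℕ.+ (h ℕ.* 2 ℕ.+ 0))))))) ≡
    a ℕ.+ b ℕ.+ c ℕ.+ d ℕ.+ e ℕ.+ f ℕ.+ g ℕ.+ 2 ℕ.* h
  unfolded = ℕ.solve-∀

private
  regroup : ∀ a b c d → a ℕ.+ b ℕ.+ c ℕ.+ d ≡ b ℕ.+ (a ℕ.+ d) ℕ.+ c
  regroup = ℕ.solve-∀
  factor : ∀ n x y z w → x ℕ.* n ℕ.+ y ℕ.* n ℕ.+ z ℕ.* n ℕ.+ w ℕ.* n ≡ (x ℕ.+ y ℕ.+ z ℕ.+ w) ℕ.* n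
  factor = ℕ.solve-∀
  factor-s : ∀ n a b c d e f g h →
    a ℕ.* n ℕ.+ b ℕ.* n ℕ.+ c ℕ.* n ℕ.+ d ℕ.* n ℕ.+ e ℕ.* n ℕ.+ f ℕ.* n ℕ.+ g ℕ.* n ℕ.+ 2 ℕ.* (h ℕ.* (2 ℕ.* n)) ≡
    (a ℕ.+ b ℕ.+ c ℕ.+ d ℕ.+ e ℕ.+ f ℕ.+ g ℕ.+ 4 ℕ.* h) ℕ.* n
  factor-s = ℕ.solve-∀

module Core (n : ℕ) .{{_ : NonZero n}} where
  private instance
    2n≢0 : NonZero (2 ℕ.* n)
    2n≢0 = ℕ.m*n≢0 2 n

  -- The multiplicity of the last generator may be as large as 4n - 1; smaller values shorten
  -- the sequence to the required length.
  coreMults : ℕ → Vec ℕ 8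
  coreMults last = q ∷ q ∷ q ∷ q ∷ q ∷ q ∷ q ∷ last ∷ []
    where q = 2 ℕ.* n ℕ.∸ 1

  coreSeq : ℕ → Seq (⨁C (coreFactors n))
  coreSeq last = blocks (Vec.map (element (coreFactors n)) coreWeights) (coreMults last)

  ≤∸1⇒< : ∀ {a} m .{{_ : NonZero m}} → a ≤ m ℕ.∸ 1 → a < m
  ≤∸1⇒< (suc m) a≤m = s≤s a≤m

  -- Cancelling `n` turns the four divisibility conditions into `Balanced`. As `h` is θ times 2n,
  -- the term 2h of the last sum becomes 4θ.
  scaled⇒0 : ∀ {a b c d e f g h} (α β γ δ ε ζ η θ : Fin 2) →
    a ≡ toℕ α ℕ.* n → b ≡ toℕ β ℕ.* n → c ≡ toℕ γ ℕ.* n → d ≡ toℕ δ ℕ.* n →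
    e ≡ toℕ ε ℕ.* n → f ≡ toℕ ζ ℕ.* n → g ≡ toℕ η ℕ.* n → h ≡ toℕ θ ℕ.* (2 ℕ.* n) →
    2 ℕ.* n ℕ.∣ a ℕ.+ d ℕ.+ e ℕ.+ g → 2 ℕ.* n ℕ.∣ b ℕ.+ d ℕ.+ f ℕ.+ g →
    2 ℕ.* n ℕ.∣ c ℕ.+ e ℕ.+ f ℕ.+ g →
    6 ℕ.* n ℕ.∣ a ℕ.+ b ℕ.+ c ℕ.+ d ℕ.+ e ℕ.+ f ℕ.+ g ℕ.+ 2 ℕ.* h →
    a ∷ b ∷ c ∷ d ∷ e ∷ f ∷ g ∷ h ∷ [] ≡ Vec.replicate 8 0
  scaled⇒0 α β γ δ ε ζ η θ refl refl refl refl refl refl refl refl 2n∣A₁ 2n∣A₂ 2n∣A₃ 6n∣s =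
    cong scale (balanced⇒0 α β γ δ ε ζ η θ
      ( halve α δ ε η 2n∣A₁ , halve β δ ζ η 2n∣A₂ , halve γ ε ζ η 2n∣A₃
      , ℕ.*-cancelʳ-∣ {6} n (subst (6 ℕ.* n ℕ.∣_)
          (factor-s n (toℕ α) (toℕ β) (toℕ γ) (toℕ δ) (toℕ ε) (toℕ ζ) (toℕ η) (toℕ θ)) 6n∣s)))
    where
    scale : Vec (Fin 2) 8 → Vec ℕ 8
    scale (α ∷ β ∷ γ ∷ δ ∷ ε ∷ ζ ∷ η ∷ θ ∷ []) =
      toℕ α ℕ.* n ∷ toℕ β ℕ.* n ∷ toℕ γ ℕ.* n ∷ toℕ δ ℕ.* n ∷
      toℕ ε ℕ.* n ∷ toℕ ζ ℕ.* n ∷ toℕ η ℕ.* n ∷ toℕ θ ℕ.* (2 ℕ.* n) ∷ []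

    halve : ∀ (x y z w : Fin 2) →
            2 ℕ.* n ℕ.∣ toℕ x ℕ.* n ℕ.+ toℕ y ℕ.* n ℕ.+ toℕ z ℕ.* n ℕ.+ toℕ w ℕ.* n →
            2 ℕ.∣ toℕ x ℕ.+ toℕ y ℕ.+ toℕ z ℕ.+ toℕ w
    halve x y z w p = ℕ.*-cancelʳ-∣ {2} n
      (subst (2 ℕ.* n ℕ.∣_) (factor n (toℕ x) (toℕ y) (toℕ z) (toℕ w)) p)

  -- Unimodularity of `coreWeights`, used modulo `n` as back substitution: with `e`, `f`, `g`, `h`
  -- known, the third sum yields `c`; the last sum yields `b` once `c` and the `a + d` of the first
  -- are removed; then `b + d` and `a + d` yield `d` and `a`.
  all-divisible : ∀ a b c d e f g h → n ℕ.∣ e → n ℕ.∣ f → n ℕ.∣ g →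
    2 ℕ.* n ℕ.∣ a ℕ.+ d ℕ.+ e ℕ.+ g → 2 ℕ.* n ℕ.∣ b ℕ.+ d ℕ.+ f ℕ.+ g →
    2 ℕ.* n ℕ.∣ c ℕ.+ e ℕ.+ f ℕ.+ g → 2 ℕ.* n ℕ.∣ h →
    6 ℕ.* n ℕ.∣ a ℕ.+ b ℕ.+ c ℕ.+ d ℕ.+ e ℕ.+ f ℕ.+ g ℕ.+ 2 ℕ.* h →
    n ℕ.∣ a × n ℕ.∣ b × n ℕ.∣ c × n ℕ.∣ d
  all-divisible a b c d e f g h n∣e n∣f n∣g 2n∣A₁ 2n∣A₂ 2n∣A₃ 2n∣h 6n∣s =
    ∣-+ˡ a n∣a+d n∣d , n∣b , n∣c , n∣d
    where
    n∣_·n : ∀ k → n ℕ.∣ k ℕ.* n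
    n∣ k ·n = ℕ.n∣m*n k
    n∣a+d : n ℕ.∣ a ℕ.+ d
    n∣a+d = ∣-+ˡ (a ℕ.+ d) (∣-+ˡ (a ℕ.+ d ℕ.+ e) (ℕ.∣-trans (n∣ 2 ·n) 2n∣A₁) n∣g) n∣e
    n∣b+d : n ℕ.∣ b ℕ.+ d
    n∣b+d = ∣-+ˡ (b ℕ.+ d) (∣-+ˡ (b ℕ.+ d ℕ.+ f) (ℕ.∣-trans (n∣ 2 ·n) 2n∣A₂) n∣g) n∣f
    n∣c : n ℕ.∣ c
    n∣c = ∣-+ˡ c
      (∣-+ˡ (c ℕ.+ e) (∣-+ˡ (c ℕ.+ e ℕ.+ f) (ℕ.∣-trans (n∣ 2 ·n) 2n∣A₃) n∣g) n∣f) n∣e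
    n∣2h : n ℕ.∣ 2 ℕ.* h
    n∣2h = ℕ.∣n⇒∣m*n 2 (ℕ.∣-trans (n∣ 2 ·n) 2n∣h)
    n∣a+b+c+d : n ℕ.∣ a ℕ.+ b ℕ.+ c ℕ.+ d
    n∣a+b+c+d = ∣-+ˡ (a ℕ.+ b ℕ.+ c ℕ.+ d) (∣-+ˡ (a ℕ.+ b ℕ.+ c ℕ.+ d ℕ.+ e)
      (∣-+ˡ (a ℕ.+ b ℕ.+ c ℕ.+ d ℕ.+ e ℕ.+ f) (∣-+ˡ (a ℕ.+ b ℕ.+ c ℕ.+ d ℕ.+ e ℕ.+ f ℕ.+ g)
        (ℕ.∣-trans (n∣ 6 ·n) 6n∣s) n∣2h) n∣g) n∣f) n∣e
    n∣b : n ℕ.∣ b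
    n∣b = ∣-+ˡ b
      (∣-+ˡ (b ℕ.+ (a ℕ.+ d)) (subst (n ℕ.∣_) (regroup a b c d) n∣a+b+c+d) n∣c) n∣a+d
    n∣d : n ℕ.∣ d
    n∣d = ℕ.∣m+n∣m⇒∣n n∣b+d n∣b

  quotient : ∀ {m} → n ℕ.∣ m → m ≤ 2 ℕ.* n ℕ.∸ 1 → Σ[ i ∈ Fin 2 ] m ≡ toℕ i ℕ.* n
  quotient n∣m m≤ = quotient<2 n∣m (≤∸1⇒< (2 ℕ.* n) m≤)

  divisible⇒0 : ∀ {last a b c d e f g h} → last < 4 ℕ.* n →
    Pointwise _≤_ (a ∷ b ∷ c ∷ d ∷ e ∷ f ∷ g ∷ h ∷ []) (coreMults last) →
    n ℕ.∣ e → n ℕ.∣ f → n ℕ.∣ g →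
    2 ℕ.* n ℕ.∣ a ℕ.+ d ℕ.+ e ℕ.+ g → 2 ℕ.* n ℕ.∣ b ℕ.+ d ℕ.+ f ℕ.+ g →
    2 ℕ.* n ℕ.∣ c ℕ.+ e ℕ.+ f ℕ.+ g → 2 ℕ.* n ℕ.∣ h →
    6 ℕ.* n ℕ.∣ a ℕ.+ b ℕ.+ c ℕ.+ d ℕ.+ e ℕ.+ f ℕ.+ g ℕ.+ 2 ℕ.* h →
    a ∷ b ∷ c ∷ d ∷ e ∷ f ∷ g ∷ h ∷ [] ≡ Vec.replicate 8 0
  divisible⇒0 {last} {a} {b} {c} {d} {e} {f} {g} {h} last<4n
    (a≤ ∷ b≤ ∷ c≤ ∷ d≤ ∷ e≤ ∷ f≤ ∷ g≤ ∷ h≤ ∷ []) n∣e n∣f n∣g 2n∣A₁ 2n∣A₂ 2n∣A₃ 2n∣h 6n∣s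
    with n∣a , n∣b , n∣c , n∣d ←
           all-divisible a b c d e f g h n∣e n∣f n∣g 2n∣A₁ 2n∣A₂ 2n∣A₃ 2n∣h 6n∣s
    with α , p ← quotient n∣a a≤ | β , q ← quotient n∣b b≤ | γ , r ← quotient n∣c c≤
       | δ , s ← quotient n∣d d≤ | ε , t ← quotient n∣e e≤ | ζ , u ← quotient n∣f f≤
       | η , v ← quotient n∣g g≤
       -- Divisibility of `h` by 2n comes from the C₂-part of (0, 1, 2), so the bound 4n leaves only
       -- the quotients 0 and 1.
       | θ , w ← quotient<2 2n∣h (subst (h <_) (ℕ.*-assoc 2 2 n) (ℕ.≤-<-trans h≤ last<4n)) =
    scaled⇒0 α β γ δ ε ζ η θ p q r s t u v w 2n∣A₁ 2n∣A₂ 2n∣A₃ 6n∣s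

  weights⇒0 : ∀ {last} → last < 4 ℕ.* n → ∀ cs → Pointwise _≤_ cs (coreMults last) →
              (∀ i → lookup (coreFactors n) i ℕ.∣ weight coreWeights cs i) →
              cs ≡ Vec.replicate 8 0
  weights⇒0 {last} last<4n (a ∷ b ∷ c ∷ d ∷ e ∷ f ∷ g ∷ h ∷ []) cs≤ div =
    divisible⇒0 last<4n cs≤
      (subst (n ℕ.∣_) (weight₀ a b c d e f g h) (div 0F))
      (subst (n ℕ.∣_) (weight₁ a b c d e f g h) (div 1F))
      (subst (n ℕ.∣_) (weight₂ a b c d e f g h) (div 2F))
      (subst (2 ℕ.* n ℕ.∣_) (weight₃ a b c d e f g h) (div 3F))
      (subst (2 ℕ.* n ℕ.∣_) (weight₄ a b c d e f g h) (div 4F))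
      (subst (2 ℕ.* n ℕ.∣_) (weight₅ a b c d e f g h) (div 5F))
      (subst (2 ℕ.* n ℕ.∣_) (weight₆ a b c d e f g h) (div 6F))
      (subst (6 ℕ.* n ℕ.∣_) (weight₇ a b c d e f g h) (div 7F))

  -- A zero-sum subsequence has multiplicity vector n c with c in Λ. The strict bounds n (mᵢ + 1)
  -- force cᵢ ≤ mᵢ, so c describes a zero-sum subsequence over K and must be 0.
  coreSeq-zeroSumFree : ∀ {last} → last < 4 ℕ.* n → ZeroSumFree (⨁C (coreFactors n)) (coreSeq last)
  coreSeq-zeroSumFree {last} last<4n zs zs⊆ zs≢[] sum≈ε =
    zs≢[] (trans zs≡ (cong (blocks gs) (weights⇒0 last<4n cs cs≤
      (blocks≈ε⇒∣weight (coreFactors n) coreWeights cs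
        (subst (λ zs → sum (⨁C (coreFactors n)) zs G.≈ G.ε) zs≡ sum≈ε)))))
    where
    module G = AbelianGroup (⨁C (coreFactors n))
    gs = Vec.map (element (coreFactors n)) coreWeights
    counts = ⊆-blocks gs (coreMults last) zs⊆
    cs = proj₁ counts
    cs≤ = proj₁ (proj₂ counts)
    zs≡ = proj₂ (proj₂ counts)

-- Direct sums of sequences

Car : ∀ {s} → Vec ℕ s → Set
Car ns = AbelianGroup.Carrier (⨁C ns)

single : ∀ {n} → ℤ → Car (n ∷ [])
single x = x , tt

single-mono : ∀ n → IsMonoidMonomorphism (C n) (⨁C (n ∷ [])) (single {n})
single-mono n = record
  { isMonoidHomomorphism = monoidHom (C n) (⨁C (n ∷ [])) (single {n}) (λ p → p , tt)
      (λ x y → AbelianGroup.refl (C n) {x ℤ.+ y} , tt) (AbelianGroup.refl (C n) {0ℤ} , tt)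
  ; injective = proj₁
  }

module _ {t} (ys : Vec ℕ t) where
  private
    module Y = AbelianGroup (⨁C ys)

  padʳ : ∀ {s} (xs : Vec ℕ s) → Car xs → Car (xs Vec.++ ys)
  padʳ []       _       = Y.ε
  padʳ (n ∷ xs) (x , u) = x , padʳ xs u

  padˡ : ∀ {s} (xs : Vec ℕ s) → Car ys → Car (xs Vec.++ ys)
  padˡ []       v = v
  padˡ (n ∷ xs) v = 0ℤ , padˡ xs v

  dropˡ : ∀ {s} (xs : Vec ℕ s) → Car (xs Vec.++ ys) → Car ys
  dropˡ []       v       = v
  dropˡ (n ∷ xs) (_ , v) = dropˡ xs v

  dropˡ-padˡ : ∀ {s} (xs : Vec ℕ s) v → dropˡ xs (padˡ xs v) ≡ v
  dropˡ-padˡ []       v = refl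
  dropˡ-padˡ (n ∷ xs) v = dropˡ-padˡ xs v

  dropˡ-padʳ : ∀ {s} (xs : Vec ℕ s) u → dropˡ xs (padʳ xs u) ≡ Y.ε
  dropˡ-padʳ []       u       = refl
  dropˡ-padʳ (n ∷ xs) (_ , u) = dropˡ-padʳ xs u

  dropˡ-hom : ∀ {s} (xs : Vec ℕ s) → IsMonoidHomomorphism (⨁C (xs Vec.++ ys)) (⨁C ys) (dropˡ xs)
  dropˡ-hom xs = monoidHom (⨁C (xs Vec.++ ys)) (⨁C ys) (dropˡ xs)
    (λ {u} {v} → pres xs {u} {v}) (homo xs) (ε-homo xs)
    where
    pres : ∀ {s} (xs : Vec ℕ s) {u v} → AbelianGroup._≈_ (⨁C (xs Vec.++ ys)) u v →
           dropˡ xs u Y.≈ dropˡ xs v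
    pres []       p       = p
    pres (n ∷ xs) {_ , u} {_ , v} (_ , p) = pres xs {u} {v} p
    homo : ∀ {s} (xs : Vec ℕ s) u v →
           dropˡ xs (AbelianGroup._∙_ (⨁C (xs Vec.++ ys)) u v) Y.≈ dropˡ xs u Y.∙ dropˡ xs v
    homo []       u       v       = Y.refl
    homo (n ∷ xs) (_ , u) (_ , v) = homo xs u v
    ε-homo : ∀ {s} (xs : Vec ℕ s) → dropˡ xs (AbelianGroup.ε (⨁C (xs Vec.++ ys))) Y.≈ Y.ε
    ε-homo []       = Y.refl
    ε-homo (n ∷ xs) = ε-homo xs

  padʳ-mono : ∀ {s} (xs : Vec ℕ s) → IsMonoidMonomorphism (⨁C xs) (⨁C (xs Vec.++ ys)) (padʳ xs)
  padʳ-mono xs = record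
    { isMonoidHomomorphism = monoidHom (⨁C xs) (⨁C (xs Vec.++ ys)) (padʳ xs)
        (λ {u} {v} → pres xs {u} {v}) (homo xs) (ε-homo xs)
    ; injective = λ {u} {v} → inj xs {u} {v}
    }
    where
    pres : ∀ {s} (xs : Vec ℕ s) {u v} → AbelianGroup._≈_ (⨁C xs) u v →
            AbelianGroup._≈_ (⨁C (xs Vec.++ ys)) (padʳ xs u) (padʳ xs v)
    pres []       _ = Y.refl
    pres (n ∷ xs) {_ , u} {_ , v} (p , q) = p , pres xs {u} {v} q
    homo : ∀ {s} (xs : Vec ℕ s) u v → let module G = AbelianGroup (⨁C (xs Vec.++ ys)) in
           padʳ xs (AbelianGroup._∙_ (⨁C xs) u v) G.≈ padʳ xs u G.∙ padʳ xs v
    homo []       _       _       = Y.sym (Y.identityˡ Y.ε)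
    homo (n ∷ xs) (x , u) (y , v) = AbelianGroup.refl (C n) {x ℤ.+ y} , homo xs u v
    ε-homo : ∀ {s} (xs : Vec ℕ s) → let module G = AbelianGroup (⨁C (xs Vec.++ ys)) in
             padʳ xs (AbelianGroup.ε (⨁C xs)) G.≈ G.ε
    ε-homo []       = Y.refl
    ε-homo (n ∷ xs) = AbelianGroup.refl (C n) {0ℤ} , ε-homo xs
    inj : ∀ {s} (xs : Vec ℕ s) {u v} →
          AbelianGroup._≈_ (⨁C (xs Vec.++ ys)) (padʳ xs u) (padʳ xs v) →
          AbelianGroup._≈_ (⨁C xs) u v
    inj []       _ = tt
    inj (n ∷ xs) {_ , u} {_ , v} (p , q) = p , inj xs {u} {v} q

  infixr 5 _⊕_
  _⊕_ : ∀ {s} {xs : Vec ℕ s} → Seq (⨁C xs) → Seq (⨁C ys) → Seq (⨁C (xs Vec.++ ys))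
  _⊕_ {xs = xs} S T = map (padʳ xs) S ++ map (padˡ xs) T

  length-⊕ : ∀ {s} (xs : Vec ℕ s) S T → length (_⊕_ {xs = xs} S T) ≡ length S ℕ.+ length T
  length-⊕ xs S T = trans (length-++ (map (padʳ xs) S))
    (cong₂ ℕ._+_ (length-map (padʳ xs) S) (length-map (padˡ xs) T))

  -- The projection `dropˡ` kills the terms coming from `S` and recovers those of `T`, so
  -- `zeroSumFree-extension` applies.
  zeroSumFree-⊕ : ∀ {s} (xs : Vec ℕ s) {S T} → ZeroSumFree (⨁C xs) S → ZeroSumFree (⨁C ys) T →
                  ZeroSumFree (⨁C (xs Vec.++ ys)) (_⊕_ {xs = xs} S T)
  zeroSumFree-⊕ xs {S} {T} zsf-S zsf-T =
    Hom.zeroSumFree-extension (⨁C (xs Vec.++ ys)) (⨁C ys) (dropˡ-hom xs)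
      (Mono.zeroSumFree-map (⨁C xs) (⨁C (xs Vec.++ ys)) (padʳ-mono xs) zsf-S)
      (subst (ZeroSumFree (⨁C ys)) (sym drop-map) zsf-T)
      (AllP.map⁺ (All.universal (λ u → Y.reflexive (dropˡ-padʳ xs u)) S))
    where
    drop-map : map (dropˡ xs) (map (padˡ xs) T) ≡ T
    drop-map = trans (sym (map-∘ T)) (trans (map-cong (dropˡ-padˡ xs) T) (map-id T))

module _ (m : ℕ) where
  copies : Seq (⨁C (m ∷ []))
  copies = map (single {m}) (replicate (m ℕ.∸ 1) 1ℤ)

  length-copies : length copies ≡ m ℕ.∸ 1
  length-copies =
    trans (length-map (single {m}) (replicate (m ℕ.∸ 1) 1ℤ)) (length-replicate (m ℕ.∸ 1))

  -- The usual zero-sum free sequence of length d* over C_m^j, with m - 1 copies of each basis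
  -- element; it fills the summands beyond rank 9.
  standard : ∀ j → Seq (⨁C (Vec.replicate j m))
  standard zero    = []
  standard (suc j) = _⊕_ (Vec.replicate j m) {xs = m ∷ []} copies (standard j)

  length-standard : ∀ j → length (standard j) ≡ j ℕ.* (m ℕ.∸ 1)
  length-standard zero    = refl
  length-standard (suc j) =
    trans (length-⊕ (Vec.replicate j m) (m ∷ []) copies (standard j))
      (cong₂ ℕ._+_ length-copies (length-standard j))

  standard-zeroSumFree : .{{_ : NonZero m}} → ∀ j → ZeroSumFree (⨁C (Vec.replicate j m)) (standard j)
  standard-zeroSumFree zero    [] [] []≢[] _ = []≢[] refl
  standard-zeroSumFree (suc j) = zeroSumFree-⊕ (Vec.replicate j m) (m ∷ [])
    (Mono.zeroSumFree-map (C m) (⨁C (m ∷ [])) (single-mono m)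
      (zeroSumFree-replicate (C m) (C-order-1 m) (∸1< m)))
    (standard-zeroSumFree j)
    where
    ∸1< : ∀ m .{{_ : NonZero m}} → m ℕ.∸ 1 < m
    ∸1< (suc m) = ℕ.≤-refl

-- Constant vectors, rational bounds and the length count

All-replicate : ∀ {P : ℕ → Set} {m} → P m → ∀ j → VecAll.All P (Vec.replicate j m)
All-replicate p zero    = VecAll.[]
All-replicate p (suc j) = p VecAll.∷ All-replicate p j

Linked-replicate : ∀ m j → VecLinked.Linked ℕ._∣_ (m ∷ Vec.replicate j m)
Linked-replicate m zero    = VecLinked.[-]
Linked-replicate m (suc j) = ℕ.∣-refl VecLinked.∷ Linked-replicate m j

sum-map-replicate : ∀ (f : ℕ → ℕ) m j → Vec.sum (Vec.map f (Vec.replicate j m)) ≡ j ℕ.* f m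
sum-map-replicate f m zero    = refl
sum-map-replicate f m (suc j) = cong (f m ℕ.+_) (sum-map-replicate f m j)

i≤∣i∣ : ∀ i → i ℤ.≤ + ∣ i ∣
i≤∣i∣ (+ n)    = ℤ.≤-refl
i≤∣i∣ -[1+ n ] = ℤ.-≤+

archimedean : ∀ q → ∃[ m ] q ℚ.< + m ℚ./ 2
archimedean q@(mkℚ n d-1 _) = m , ℚ.toℚᵘ-cancel-<
  (ℚᵘ.<-respʳ-≃ (ℚᵘ.≃-sym (ℚ.toℚᵘ-fromℚᵘ (ℚᵘ.mkℚᵘ (+ m) 1))) (ℚᵘ.*<* bound))
  where
  -- For `q` = n / d this gives q ≤ |n| < m / 2, the denominator d being at least 1.
  m = suc (∣ n ∣ ℕ.* 2)
  bound : n ℤ.* + 2 ℤ.< + m ℤ.* + suc d-1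
  bound = begin-strict
    n ℤ.* + 2            ≤⟨ ℤ.*-monoʳ-≤-nonNeg (+ 2) (i≤∣i∣ n) ⟩
    + ∣ n ∣ ℤ.* + 2      ≡⟨ ℤ.pos-* ∣ n ∣ 2 ⟨
    + (∣ n ∣ ℕ.* 2)      <⟨ ℤ.+<+ ℕ.≤-refl ⟩
    + m                  ≤⟨ ℤ.+≤+ (ℕ.m≤m*n m (suc d-1)) ⟩
    + (m ℕ.* suc d-1)    ≡⟨ ℤ.pos-* m (suc d-1) ⟩
    + m ℤ.* + suc d-1    ∎
    where open ℤ.≤-Reasoning

-- Each summand is at most 1. Hence the bound in `CrossNumberBound` never exceeds the rank, however
-- large the factors are.
Σ[n-1]/n≤s : ∀ {s} {ns : Vec ℕ s} (1<ns : VecAll.All (1 <_) ns) → Σ[n-1]/n 1<ns ℚ.≤ + s ℚ./ 1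
Σ[n-1]/n≤s VecAll.[] = ℚ.≤-refl
Σ[n-1]/n≤s {suc s} (VecAll._∷_ {x = n} 1<n 1<ns) = ℚ.≤-trans
  (ℚ.+-mono-≤
    (/-mono-≤ {n ℕ.∸ 1} {n} {1} {1} {{ℕ.>-nonZero (ℕ.<-trans ℕ.z<s 1<n)}} bound)
    (Σ[n-1]/n≤s 1<ns))
  (ℚ.≤-reflexive (1/d+m/d 1 s))
  where
  bound : (n ℕ.∸ 1) ℕ.* 1 ≤ 1 ℕ.* n
  bound = subst₂ _≤_ (sym (ℕ.*-identityʳ _)) (sym (ℕ.*-identityˡ n)) (ℕ.m∸n≤m n 1)

-- Apart from `F`, the contribution of the summands beyond rank 9, both sides equal 18n - 9. Writing
-- `n` as `suc p` removes the truncated subtractions, after which the ring solver applies.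
length-count : ∀ n .{{_ : NonZero n}} t last F → t ℕ.+ last ≡ 4 ℕ.* n ℕ.∸ 2 →
  t ℕ.+ (Vec.sum (Core.coreMults n last) ℕ.+ F) ≡
  (n ℕ.∸ 1) ℕ.+ ((n ℕ.∸ 1) ℕ.+ ((n ℕ.∸ 1) ℕ.+ ((n ℕ.∸ 1) ℕ.+
  ((2 ℕ.* n ℕ.∸ 1) ℕ.+ ((2 ℕ.* n ℕ.∸ 1) ℕ.+ ((2 ℕ.* n ℕ.∸ 1) ℕ.+ ((2 ℕ.* n ℕ.∸ 1) ℕ.+
  ((6 ℕ.* n ℕ.∸ 1) ℕ.+ F))))))))
length-count (suc p) t last F eq = trans (collect p t last F) (trans
  (cong (ℕ._+ (7 ℕ.* (p ℕ.+ suc (p ℕ.+ 0)) ℕ.+ F)) (trans eq (4n∸2 p)))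
  (expand p F))
  where
  4n∸2 : ∀ p → 4 ℕ.* suc p ℕ.∸ 2 ≡ 2 ℕ.+ 4 ℕ.* p
  4n∸2 p = cong (ℕ._∸ 2) (4n p)
    where
    4n : ∀ p → 4 ℕ.* suc p ≡ 4 ℕ.+ 4 ℕ.* p
    4n = ℕ.solve-∀
  collect : ∀ p t last F → let q = p ℕ.+ suc (p ℕ.+ 0) in
    t ℕ.+ (q ℕ.+ (q ℕ.+ (q ℕ.+ (q ℕ.+ (q ℕ.+ (q ℕ.+ (q ℕ.+ (last ℕ.+ 0))))))) ℕ.+ F) ≡
    t ℕ.+ last ℕ.+ (7 ℕ.* q ℕ.+ F)
  collect = ℕ.solve-∀
  expand : ∀ p F → let q = p ℕ.+ suc (p ℕ.+ 0) in
    2 ℕ.+ 4 ℕ.* p ℕ.+ (7 ℕ.* q ℕ.+ F) ≡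
    p ℕ.+ (p ℕ.+ (p ℕ.+ (p ℕ.+ (q ℕ.+ (q ℕ.+ (q ℕ.+ (q ℕ.+
    ((p ℕ.+ suc (p ℕ.+ suc (p ℕ.+ suc (p ℕ.+ suc (p ℕ.+ suc (p ℕ.+ 0)))))) ℕ.+ F))))))))
  expand = ℕ.solve-∀

-- The example of rank 9 + j

module Example (j m : ℕ) where
  private
    n = pronic m
    instance
      n≢0 : NonZero n
      n≢0 = pronic-nonZero m
      6n≢0 : NonZero (6 ℕ.* n)
      6n≢0 = ℕ.m*n≢0 6 n
    module H = Heavy (heavy m)
    t = length H.seq

  top : Vec ℕ j
  top = Vec.replicate j (6 ℕ.* n)

  rest : Vec ℕ (8 ℕ.+ j)
  rest = coreFactors n Vec.++ top

  -- The divisibility chain dictates the order: the summand C_n carrying `T` comes first, the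
  -- additional copies of C_{6n} last.
  factors : Vec ℕ (9 ℕ.+ j)
  factors = n ∷ rest

  G : Ab
  G = ⨁C factors

  n≤_*n : ∀ i .{{_ : NonZero i}} → n ≤ i ℕ.* n
  n≤ i *n = ℕ.m≤n*m n i

  1<factors : VecAll.All (1 <_) factors
  1<factors = 1<n ∷ 1<n ∷ 1<n ∷ 1<n ∷ 1<2n ∷ 1<2n ∷ 1<2n ∷ 1<2n ∷ 1<6n ∷ All-replicate 1<6n j
    where
    open VecAll using (_∷_)
    1<n = 1<pronic m
    1<2n = ℕ.<-≤-trans 1<n (n≤ 2 *n)
    1<6n = ℕ.<-≤-trans 1<n (n≤ 6 *n)

  n∣factors : VecAll.All (n ℕ.∣_) factors
  n∣factors = n∣n ∷ n∣n ∷ n∣n ∷ n∣n ∷ n∣2n ∷ n∣2n ∷ n∣2n ∷ n∣2n ∷ n∣6n ∷ All-replicate n∣6n j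
    where
    open VecAll using (_∷_)
    n∣n = ℕ.∣-refl {n}
    n∣2n = ℕ.n∣m*n 2 {n}
    n∣6n = ℕ.n∣m*n 6 {n}

  2n∣6n : 2 ℕ.* n ℕ.∣ 6 ℕ.* n
  2n∣6n = subst (2 ℕ.* n ℕ.∣_) (sym (ℕ.*-assoc 3 2 n)) (ℕ.n∣m*n 3)

  factors∣6n : VecAll.All (ℕ._∣ 6 ℕ.* n) factors
  factors∣6n = n∣6n ∷ n∣6n ∷ n∣6n ∷ n∣6n ∷ 2n∣6n ∷ 2n∣6n ∷ 2n∣6n ∷ 2n∣6n ∷ ℕ.∣-refl ∷
    All-replicate ℕ.∣-refl j
    where
    open VecAll using (_∷_)
    n∣6n = ℕ.n∣m*n 6 {n}

  chain : VecLinked.Linked ℕ._∣_ factors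
  chain = ℕ.∣-refl ∷ ℕ.∣-refl ∷ ℕ.∣-refl ∷ ℕ.n∣m*n 2 ∷ ℕ.∣-refl ∷ ℕ.∣-refl ∷ ℕ.∣-refl ∷ 2n∣6n ∷
    Linked-replicate (6 ℕ.* n) j
    where open VecLinked using (_∷_)

  invariantFactors : InvariantFactors G (9 ℕ.+ j)
  invariantFactors = record
    { factors = factors ; 1< = 1<factors ; chain = chain
    ; iso = id , Identity.isGroupIsomorphism (AbelianGroup.rawGroup G) (λ {x} → AbelianGroup.refl G {x}) }

  finite : Finite G
  finite = ⨁C-finite (VecAll.map (λ 1<k → ℕ.>-nonZero (ℕ.<-trans ℕ.z<s 1<k)) 1<factors)

  -- `n` exceeds 1 and divides every factor, so counting modulo `n` excludes smaller generating
  -- sets.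
  hasRank : HasRank G (9 ℕ.+ j)
  hasRank = Rank.rank factors n n∣factors (1<pronic m)

  -- The first nine summands call for 18n - 9 terms, of which the other seven core generators take
  -- 14n - 7; `T` and the last generator share the remaining 4n - 2. Since `t` < n ≤ 4n - 2, the
  -- subtraction is not truncated.
  last : ℕ
  last = 4 ℕ.* n ℕ.∸ 2 ℕ.∸ t

  2≤4n : 2 ≤ 4 ℕ.* n
  2≤4n = ℕ.≤-trans (1<pronic m) (n≤ 4 *n)

  last<4n : last < 4 ℕ.* n
  last<4n = ℕ.≤-<-trans (ℕ.m∸n≤m (4 ℕ.* n ℕ.∸ 2) t)
    (ℕ.∸-monoʳ-< {4 ℕ.* n} {2} {0} ℕ.z<s 2≤4n)

  t+last : t ℕ.+ last ≡ 4 ℕ.* n ℕ.∸ 2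
  t+last = ℕ.m+[n∸m]≡n (ℕ.≤-trans (ℕ.<⇒≤ H.short) n≤4n∸2)
    where
    n≤4n∸2 : n ≤ 4 ℕ.* n ℕ.∸ 2
    n≤4n∸2 = ℕ.m+n≤o⇒m≤o∸n n
      (ℕ.≤-trans (ℕ.+-monoʳ-≤ n (1<pronic m)) (ℕ.+-monoʳ-≤ n (n≤ 3 *n)))

  open Core n using (coreMults; coreSeq; coreSeq-zeroSumFree)

  tail : Seq (⨁C rest)
  tail = _⊕_ top {xs = coreFactors n} (coreSeq last) (standard (6 ℕ.* n) j)

  S : Seq G
  S = _⊕_ rest {xs = n ∷ []} (map (single {n}) H.seq) tail

  S-zeroSumFree : ZeroSumFree G S
  S-zeroSumFree = zeroSumFree-⊕ rest (n ∷ [])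
    (Mono.zeroSumFree-map (C n) (⨁C (n ∷ [])) (single-mono n) H.zeroSumFree)
    (zeroSumFree-⊕ top (coreFactors n) (coreSeq-zeroSumFree last<4n) (standard-zeroSumFree (6 ℕ.* n) j))

  length-S : length S ≡ d* invariantFactors
  length-S = begin
    length S
      ≡⟨ length-⊕ rest (n ∷ []) (map (single {n}) H.seq) tail ⟩
    length (map (single {n}) H.seq) ℕ.+ length tail
      ≡⟨ cong₂ ℕ._+_ (length-map (single {n}) H.seq)
           (length-⊕ top (coreFactors n) (coreSeq last) (standard (6 ℕ.* n) j)) ⟩
    t ℕ.+ (length (coreSeq last) ℕ.+ length (standard (6 ℕ.* n) j))
      ≡⟨ cong (t ℕ.+_) (cong₂ ℕ._+_
           (length-blocks (Vec.map (element (coreFactors n)) coreWeights) (coreMults last))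
           standard-sum) ⟩
    t ℕ.+ (Vec.sum (coreMults last) ℕ.+ Vec.sum (Vec.map (ℕ._∸ 1) top))
      ≡⟨ length-count n t last (Vec.sum (Vec.map (ℕ._∸ 1) top)) t+last ⟩
    d* invariantFactors ∎
    where
    open ≡-Reasoning
    standard-sum : length (standard (6 ℕ.* n) j) ≡ Vec.sum (Vec.map (ℕ._∸ 1) top)
    standard-sum = trans (length-standard (6 ℕ.* n) j) (sym (sum-map-replicate (ℕ._∸ 1) (6 ℕ.* n) j))

  heavyOrders : All (Order G) (map (padʳ rest (n ∷ [])) (map (single {n}) H.seq))
  heavyOrders = Mono.orders-map (⨁C (n ∷ [])) G (padʳ-mono rest (n ∷ []))
    (Mono.orders-map (C n) (⨁C (n ∷ [])) (single-mono n) H.orders)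

  tailOrders : All (Order G) (map (padˡ rest (n ∷ [])) tail)
  tailOrders = All.universal (⨁C-order (6 ℕ.* n) factors∣6n) _

  orders : All (Order G) S
  orders = AllP.++⁺ heavyOrders tailOrders

  -- Only the terms of `T` are counted: the embeddings preserve orders, and the remaining terms
  -- contribute at least 0.
  k-orders : + m ℚ./ 2 ℚ.≤ k G orders
  k-orders = begin
    + m ℚ./ 2                         ≤⟨ H.k≥ ⟩
    k (C n) H.orders                  ≡⟨ Mono.k-map (C n) (⨁C (n ∷ [])) (single-mono n) H.orders ⟨
    k (⨁C (n ∷ [])) singleOrders      ≡⟨ Mono.k-map (⨁C (n ∷ [])) G (padʳ-mono rest (n ∷ [])) singleOrders ⟨
    k G heavyOrders                   ≡⟨ ℚ.+-identityʳ _ ⟨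
    k G heavyOrders ℚ.+ 0ℚ            ≤⟨ ℚ.+-monoʳ-≤ (k G heavyOrders) (0≤k G tailOrders) ⟩
    k G heavyOrders ℚ.+ k G tailOrders ≡⟨ k-++ G heavyOrders tailOrders ⟨
    k G orders                        ∎
    where
    open ℚ.≤-Reasoning
    singleOrders = Mono.orders-map (C n) (⨁C (n ∷ [])) (single-mono n) H.orders

-- Unbounded cross numbers and failure of the bound in rank 9 + j

largeCrossNumber : ∀ j (M : ℝ) → Σ[ G ∈ Ab ] Finite G × HasRank G (9 ℕ.+ j) ×
  (Σ[ S ∈ Seq G ] ZeroSumFree G S × (∃[ s ] Σ[ D ∈ InvariantFactors G s ] length S ≡ d* D) ×
  (Σ[ o ∈ All (Order G) S ] M <ʳ k G o))
largeCrossNumber j M with q , U-q ← ℝ.U-inhabited M with m , q<m/2 ← archimedean q =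
  G , finite , hasRank , S , S-zeroSumFree , (9 ℕ.+ j , invariantFactors , length-S) , orders ,
  -- `q` lies in the upper cut of `M` and below the cross number, so roundedness puts the latter in
  -- the upper cut too.
  Equivalence.from (ℝ.U-rounded M (k G orders)) (q , ℚ.<-≤-trans q<m/2 k-orders , U-q)
  where open Example j m

-- The alleged bound is at most the rank 9 + j, whereas `m` is chosen with m / 2 above it.
¬crossNumberBound : ∀ j → ¬ CrossNumberBound (9 ℕ.+ j)
¬crossNumberBound j bound = ℚ.<-irrefl refl (ℚ.<-≤-trans (ℚ.<-≤-trans r<m/2 k-orders) (ℚ.≤-trans
  (bound G finite invariantFactors S S-zeroSumFree (ℕ.≤-reflexive (sym length-S)) orders)
  (Σ[n-1]/n≤s 1<factors)))
  where
  m = proj₁ (archimedean (+ (9 ℕ.+ j) ℚ./ 1))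
  r<m/2 = proj₂ (archimedean (+ (9 ℕ.+ j) ℚ./ 1))
  open Example j m

theorem5p1 : (∀ (r : ℕ) → 9 ≤ r →
    (∀ (M : ℝ) → Positive M →
    Σ[ G ∈ AbelianGroup 0ℓ 0ℓ ] Finite G × HasRank G r ×
    (Σ[ S ∈ Seq G ] ZeroSumFree G S ×
    (∃[ s ] Σ[ D ∈ InvariantFactors G s ] length S ≡ d* D) ×
    (Σ[ o ∈ All (Order G) S ] M <ʳ k G o)))
    × ¬ CrossNumberBound r)
    × ¬ (∀ (r : ℕ) → CrossNumberBound r)
theorem5p1 = from-9 , λ bound → ¬crossNumberBound 0 (bound 9)
  where
  from-9 : ∀ r → 9 ≤ r → _
  from-9 r 9≤r with j , refl ← ℕ.m≤n⇒∃[o]m+o≡n 9≤r =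
    (λ M _ → largeCrossNumber j M) , ¬crossNumberBound j
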